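{- For any probability distribution on regular bipartite graphs with $2n$ nodes, there exists a deterministic algorithm for finding a perfect matching that runs in average time $O(n\log n)$ on graphs drawn from this distribution.
   Context: A bipartite graph $G=(P,Q,E)$ has vertex set $P\cup Q$ and edge set $E\subseteq P\times Q$; it is regular if all its vertices have the same degree $d\geq 1$, in which case $|P|=|Q|=n$. Graphs are given in adjacency array representation: for each vertex, its neighbors are stored in an array whose entries can be accessed in constant time, in arbitrary order. The deterministic algorithm may depend on the distribution (and on $n$). Average time means expected running time over the random input graph drawn from the distribution; the constant implied by $O(\cdot)$ is absolute. -}

module Defs where

open import Algebra.Bundles using (CommutativeMonoid)
import Algebra.Properties.CommutativeSemigroup as CommutativeSemigroupₚ
open import Data.Bool using (Bool; true; if_then_else_)
open import Data.Fin using (Fin; toℕ; fromℕ<)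
open import Data.Fin.Subset using (∣_∣)
open import Data.Integer using (+_)
open import Data.List using (List; []; _∷_)
open import Data.Maybe using (Maybe; just; nothing)
open import Data.Nat using (ℕ; zero; suc; _≤_; _<?_; _≡ᵇ_; _⊔_)
  renaming (_+_ to _+ℕ_; _∸_ to _∸ℕ_)
import Data.Nat.Properties as ℕₚ
open import Data.Product using (∃; ∃-syntax; ∃!; _×_; _,_)
open import Data.Rational using (ℚ; 0ℚ; ½)
  renaming (_+_ to _+ℚ_; _-_ to _-ℚ_; _*_ to _*ℚ_; _≤_ to _≤ℚ_; _<_ to _<ℚ_; ∣_∣ to ∣_∣ℚ; _/_ to _/ℚ_)
import Data.Rational as ℚ
import Data.Rational.Properties as ℚₚ
open import Data.Vec using (tabulate)
open import Data.Vec.Functional using (Vector; foldr)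
open import Function.Bundles using (_⇔_)
open import Function.Definitions using (Injective)
open import Relation.Binary.PropositionalEquality
  using (_≡_; refl; sym; trans; cong)
open import Relation.Nullary using (yes; no)

Cauchy : (ℕ → ℚ) → Set
Cauchy x = ∀ (ε : ℚ) → 0ℚ <ℚ ε →
           ∃[ N ] (∀ i j → N ≤ i → N ≤ j → ∣ x i -ℚ x j ∣ℚ ≤ℚ ε)

record ℝ : Set where
  constructor mkℝ
  field
    seq    : ℕ → ℚ
    cauchy : Cauchy seq
open ℝ public

infix 4 _≤ℝ_ _≃ℝ_
infixl 6 _+ℝ_
infixl 7 _·_

_≤ℝ_ : ℝ → ℝ → Set
x ≤ℝ y = ∀ (ε : ℚ) → 0ℚ <ℚ ε → ∃[ N ] (∀ i → N ≤ i → seq x i ≤ℚ seq y i +ℚ ε)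

_≃ℝ_ : ℝ → ℝ → Set
x ≃ℝ y = x ≤ℝ y × y ≤ℝ x

fromℚ : ℚ → ℝ
fromℚ q = mkℝ (λ _ → q) λ ε 0<ε → 0 , λ _ _ _ _ →
  ℚₚ.≤-trans (ℚₚ.≤-reflexive (cong ∣_∣ℚ (ℚₚ.+-inverseʳ q))) (ℚₚ.<⇒≤ 0<ε)

fromℕ : ℕ → ℝ
fromℕ n = fromℚ (+ n /ℚ 1)

0ℝ 1ℝ : ℝ
0ℝ = fromℕ 0
1ℝ = fromℕ 1

private
  half-pos : ∀ {ε} → 0ℚ <ℚ ε → 0ℚ <ℚ ε *ℚ ½
  half-pos {ε} 0<ε =
    ℚₚ.positive⁻¹ (ε *ℚ ½) {{ℚₚ.pos*pos⇒pos ε {{ℚ.positive 0<ε}} ½}}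

  half+half : ∀ ε → ε *ℚ ½ +ℚ ε *ℚ ½ ≡ ε
  half+half ε = trans (sym (ℚₚ.*-distribˡ-+ ε ½ ½)) (ℚₚ.*-identityʳ ε)

  interchange : ∀ a b c d → (a +ℚ b) -ℚ (c +ℚ d) ≡ (a -ℚ c) +ℚ (b -ℚ d)
  interchange a b c d = trans (cong (a +ℚ b +ℚ_) (ℚₚ.neg-distrib-+ c d))
    (CommutativeSemigroupₚ.interchange
      (CommutativeMonoid.commutativeSemigroup ℚₚ.+-0-commutativeMonoid) a b (ℚ.- c) (ℚ.- d))

  +-cauchy : ∀ {x y} → Cauchy x → Cauchy y → Cauchy (λ i → x i +ℚ y i)
  +-cauchy {x} {y} cx cy ε 0<ε with cx (ε *ℚ ½) (half-pos 0<ε) | cy (ε *ℚ ½) (half-pos 0<ε)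
  ... | M , hx | N , hy = M ⊔ N , λ i j p q → begin
    ∣ (x i +ℚ y i) -ℚ (x j +ℚ y j) ∣ℚ     ≡⟨ cong ∣_∣ℚ (interchange (x i) (y i) (x j) (y j)) ⟩
    ∣ (x i -ℚ x j) +ℚ (y i -ℚ y j) ∣ℚ     ≤⟨ ℚₚ.∣p+q∣≤∣p∣+∣q∣ (x i -ℚ x j) (y i -ℚ y j) ⟩
    ∣ x i -ℚ x j ∣ℚ +ℚ ∣ y i -ℚ y j ∣ℚ    ≤⟨ ℚₚ.+-mono-≤
      (hx i j (ℕₚ.≤-trans (ℕₚ.m≤m⊔n M N) p) (ℕₚ.≤-trans (ℕₚ.m≤m⊔n M N) q))
      (hy i j (ℕₚ.≤-trans (ℕₚ.m≤n⊔m M N) p) (ℕₚ.≤-trans (ℕₚ.m≤n⊔m M N) q)) ⟩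
    ε *ℚ ½ +ℚ ε *ℚ ½                      ≡⟨ half+half ε ⟩
    ε                                     ∎
    where open ℚₚ.≤-Reasoning

_+ℝ_ : ℝ → ℝ → ℝ
x +ℝ y = mkℝ (λ i → seq x i +ℚ seq y i) (+-cauchy {seq x} {seq y} (cauchy x) (cauchy y))

_·_ : ℕ → ℝ → ℝ
zero  · x = 0ℝ
suc t · x = x +ℝ t · x

sumℝ : ∀ {k} → Vector ℝ k → ℝ
sumℝ = foldr _+ℝ_ 0ℝ

-- Regularity with d ≥ 1 forces ∣P∣ = ∣Q∣, so both parts are Fin n.
data Part : Set where
  P Q : Part

BipartiteGraph : ℕ → Set
BipartiteGraph n = Fin n → Fin n → Bool

Edge : ∀ {n} → BipartiteGraph n → Fin n → Fin n → Set
Edge E p q = E p q ≡ true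

adjacent : ∀ {n} → BipartiteGraph n → Part → Fin n → Fin n → Bool
adjacent E P p q = E p q
adjacent E Q q p = E p q

degree : ∀ {n} → BipartiteGraph n → Part → Fin n → ℕ
degree E s v = ∣ tabulate (adjacent E s v) ∣

Regular : ∀ {n} → BipartiteGraph n → ℕ → Set
Regular E d = 1 ≤ d × (∀ s v → degree E s v ≡ d)

IsPerfectMatching : ∀ {n} → BipartiteGraph n → (Fin n → Fin n → Set) → Set
IsPerfectMatching E M =
    (∀ p q → M p q → Edge E p q)
  × (∀ p → ∃! _≡_ λ q → M p q)
  × (∀ q → ∃! _≡_ λ p → M p q)

-- A regular bipartite graph given by adjacency arrays: the array of a vertex
-- lists its neighbours without repetition, in an order that is part of the
-- input.
record Input (n : ℕ) : Set where
  field
    graph     : BipartiteGraph n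
    d         : ℕ
    regular   : Regular graph d
    array     : Part → Fin n → Fin d → Fin n
    injective : ∀ s v → Injective _≡_ _≡_ (array s v)
    lists     : ∀ s v w → (adjacent graph s v w ≡ true) ⇔ (∃ λ i → array s v i ≡ w)
open Input public

-- A regular graph on n + n vertices (n ≥ 1) has only finitely many adjacency
-- array representations, so a probability distribution on them is given by
-- finitely many outcomes with real weights. Repeated outcomes are allowed;
-- their weights add up.
record Distribution (n : ℕ) : Set where
  field
    size        : ℕ
    outcome     : Fin size → Input n
    weight      : Fin size → ℝ
    nonnegative : ∀ i → 0ℝ ≤ℝ weight i
    total       : sumℝ weight ≃ℝ 1ℝ
open Distribution public

-- Unit cost per instruction; a register is a memory cell. There is no
-- multiplication, shift or computed jump; the input is read-only and can be
-- accessed only one array entry at a time.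
data Instruction : Set where
  const     : (dst c : ℕ) → Instruction                -- M[dst] := c
  copy      : (dst a : ℕ) → Instruction                -- M[dst] := M[a]
  add       : (dst a b : ℕ) → Instruction              -- M[dst] := M[a] + M[b]
  sub       : (dst a b : ℕ) → Instruction              -- M[dst] := M[a] ∸ M[b]
  load      : (dst a : ℕ) → Instruction                -- M[dst] := M[M[a]]
  store     : (dst a : ℕ) → Instruction                -- M[M[dst]] := M[a]
  getDegree : (dst : ℕ) → Instruction                  -- M[dst] := d
  neighbour : Part → (dst a b : ℕ) → Instruction       -- M[dst] := entry M[b] of the array of vertex M[a]
  jump      : (target : ℕ) → Instruction
  jumpZero  : (a target : ℕ) → Instruction             -- jump if M[a] = 0
  halt      : Instruction

Program : Set
Program = List Instruction

Memory : Set
Memory = ℕ → ℕ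

_[_≔_] : Memory → ℕ → ℕ → Memory
(m [ a ≔ x ]) b = if a ≡ᵇ b then x else m b

-- Vertices and array positions are numbered from 0; out-of-range accesses
-- return 0.
entry : ∀ {n} → Input n → Part → ℕ → ℕ → ℕ
entry {n} G s v i with v <? n | i <? d G
... | yes v<n | yes i<d = toℕ (array G s (fromℕ< v<n) (fromℕ< i<d))
... | _       | _       = 0

-- Running off the end of the program halts.
fetch : Program → ℕ → Instruction
fetch []         _        = halt
fetch (i ∷ _)    zero     = i
fetch (_ ∷ prog) (suc pc) = fetch prog pc

Config : Set
Config = ℕ × Memory

execute : ∀ {n} → Input n → Instruction → Config → Maybe Config
execute G (const dst c)         (pc , m) = just (suc pc , m [ dst ≔ c ])
execute G (copy dst a)          (pc , m) = just (suc pc , m [ dst ≔ m a ])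
execute G (add dst a b)         (pc , m) = just (suc pc , m [ dst ≔ m a +ℕ m b ])
execute G (sub dst a b)         (pc , m) = just (suc pc , m [ dst ≔ m a ∸ℕ m b ])
execute G (load dst a)          (pc , m) = just (suc pc , m [ dst ≔ m (m a) ])
execute G (store dst a)         (pc , m) = just (suc pc , m [ m dst ≔ m a ])
execute G (getDegree dst)       (pc , m) = just (suc pc , m [ dst ≔ d G ])
execute G (neighbour s dst a b) (pc , m) = just (suc pc , m [ dst ≔ entry G s (m a) (m b) ])
execute G (jump l)              (pc , m) = just (l , m)
execute G (jumpZero a l)        (pc , m) = just ((if m a ≡ᵇ 0 then l else suc pc) , m)
execute G halt                  _        = nothing

-- Runs G prog c t m: started in c, the machine halts after exactly t
-- steps with memory m.
data Runs {n} (G : Input n) (prog : Program) : Config → ℕ → Memory → Set where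
  halted : ∀ {pc m} → execute G (fetch prog pc) (pc , m) ≡ nothing →
           Runs G prog (pc , m) 0 m
  step   : ∀ {pc m c t m′} → execute G (fetch prog pc) (pc , m) ≡ just c →
           Runs G prog c t m′ → Runs G prog (pc , m) (suc t) m′

initial : Config
initial = 0 , λ _ → 0

-- The output convention: cell p holds the partner of vertex p of P.
matchingIn : ∀ {n} → Memory → Fin n → Fin n → Set
matchingIn m p q = m (toℕ p) ≡ toℕ q

-- Since the machine is deterministic, time and output are determined by
-- program through the field runs.
record PerfectMatchingAlgorithm (n : ℕ) : Set where
  field
    program : Program
    time    : Input n → ℕ
    output  : Input n → Memory
    runs    : ∀ G → Runs G program initial (time G) (output G)
    correct : ∀ G → IsPerfectMatching (graph G) (matchingIn (output G))
open PerfectMatchingAlgorithm public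

averageTime : ∀ {n} → PerfectMatchingAlgorithm n → Distribution n → ℝ
averageTime A μ = sumℝ (λ i → time A (outcome μ i) · weight μ i)

{-# OPTIONS --safe #-}
module Submission where

-- By Yao's principle it suffices to find, for every n, a randomized algorithm
-- that finds a perfect matching of every input in O(n log n) expected steps
-- (algorithm-finds, algorithmTime-log): fixing each random choice to one that is
-- no worse than the average for the weighted inputs that reach it gives a
-- deterministic algorithm, still correct on every input, whose average time is
-- at most the expected time (derandomize). Since a program may depend on n and on the distribution, and
-- only executed steps count, the algorithms are loop-free decision trees, whose
-- control state remembers all tests and all random choices made so far. A tree
-- is translated to a program of the machine by compile (compile-runs).
--
-- The randomized algorithm matches the vertices of P one after the other. When
-- k of them are left, it starts at a random one of these and walks: from a
-- vertex u of P it goes to a random neighbour q of u; if q is unmatched the walk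
-- ends, otherwise it continues from the mate of q. The last exits from the
-- vertices visited form an augmenting path that is no longer than the walk; they
-- are kept in one pointer per vertex (Trail, Leads, augment-finds).
--
-- The expected length of the walk is O(n / k). Let h t u be the expected number
-- of steps from u when the walk is abandoned after t steps. A vertex of Q has d
-- neighbours, and therefore the sum of h (t + 1) over P is at most n plus the
-- sum of h t over the matched vertices (potential-step). So the sum of h t over
-- the unmatched vertices is at most n plus the decrease, from t to t + 1, of
-- the sum of h over P. The same holds for the expected cost if abandoning the
-- walk costs B. Averaged over t < T, the decrease is at most n B / T, which is
-- harmless if T exceeds B (potential-average); hence t is chosen at random. An
-- abandoned walk is replaced by trying all walks of length n + 1; by the same
-- potential one of them ends at an unmatched vertex (not-trapped). Summing n / k
-- over k gives O(n log n) (harmonic-log).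
--
-- Finally, the real weights of the distribution are replaced by rational upper
-- bounds W i / D whose sum is at most 3 (rounding), so that the choices of
-- derandomize are made by comparing natural numbers.

open import Defs
open import Algebra.Bundles using (CommutativeRing)
import Algebra.Properties.Semiring.Sum
open import Data.Bool using (Bool; true; false; if_then_else_; T)
open import Data.Bool.Properties using () renaming (_≟_ to _≟ᵇ_)
open import Data.Empty using (⊥)
open import Data.Fin using (Fin; zero; suc; toℕ; punchIn; punchOut)
open import Data.Fin.Properties
  using (_≟_; toℕ<n; toℕ-injective; fromℕ<-toℕ; suc-injective; punchIn-punchOut; punchOut-injective)
open import Data.Fin.Subset using (∣_∣)
open import Data.Fin.Subset.Properties using (∣p∣≤n)
import Data.Integer as ℤ
import Data.Integer.Properties as ℤₚ
open import Data.List as List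
  using (List; []; _∷_; _++_; _∷ʳ_; length; allFin; cartesianProductWith)
open import Data.List.Membership.Propositional using (_∈_; lose)
open import Data.List.Membership.Propositional.Properties using (∈-allFin; ∈-cartesianProductWith⁺)
open import Data.List.Properties using (∷ʳ-++; ++-assoc; length-++; length-tabulate)
open import Data.List.Relation.Unary.Any using (Any; here; there; any?)
open import Data.Maybe using (Maybe; just; nothing; maybe′)
open import Data.Maybe.Properties using (just-injective)
open import Data.Nat hiding (_≟_)
open import Data.Nat.DivMod
open import Data.Nat.Induction using (<-wellFounded)
open import Data.Nat.Logarithm
  using (⌊log₂_⌋; ⌊log₂⌋-mono-≤; ⌊log₂⌊n/2⌋⌋≡⌊log₂n⌋∸1; ⌊log₂[2^n]⌋≡n)
open import Data.Nat.Properties renaming (_≟_ to _≟ₙ_) hiding (suc-injective)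
open import Data.Nat.Solver using (module +-*-Solver)
open import Data.Product using (∃; ∃-syntax; Σ-syntax; _×_; _,_; proj₁; proj₂)
open import Data.Rational using (ℚ; mkℚ; 0ℚ; 1ℚ; toℚᵘ; ↧ₙ_; 1/_)
  renaming (_+_ to _+ℚ_; _-_ to _-ℚ_; _*_ to _*ℚ_; _≤_ to _≤ℚ_; _<_ to _<ℚ_; ∣_∣ to ∣_∣ℚ)
import Data.Rational as ℚ
import Data.Rational.Properties as ℚₚ
open import Data.Rational.Solver using () renaming (module +-*-Solver to ℚ-Solver)
open import Data.Rational.Unnormalised using (mkℚᵘ; *≡*; *≤*)
import Data.Rational.Unnormalised as ℚᵘ
import Data.Rational.Unnormalised.Properties as ℚᵘₚ
open import Data.Sum using (_⊎_; inj₁; inj₂)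
open import Data.Vec as Vec using (Vec; []; _∷_)
open import Data.Vec.Functional using (removeAt) renaming (_∷_ to _∷ᶠ_)
open import Function using (_∘_; id)
open import Function.Bundles using (module Equivalence)
open import Function.Definitions using (Injective)
open import Induction.WellFounded using (Acc; acc)
open import Relation.Binary.PropositionalEquality hiding ([_])
open import Relation.Nullary using (yes; no; ¬_)
open import Relation.Nullary.Negation using (contradiction)

open Algebra.Properties.Semiring.Sum +-*-semiring
module ℚSum = Algebra.Properties.Semiring.Sum (CommutativeRing.semiring ℚₚ.+-*-commutativeRing)
open ℚSum using () renaming (sum to sumℚ)

-- Decision trees

-- A straight-line instruction together with its effect on the memory.
record Op : Set where
  field
    instruction : Instruction
    effect      : ∀ {n} → Input n → Memory → Memory
    sound       : ∀ {n} (G : Input n) pc m →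
                  execute G instruction (pc , m) ≡ just (suc pc , effect G m)
open Op

constᵒ loadᵒ storeᵒ : (dst a : ℕ) → Op
constᵒ dst c = record { instruction = const dst c
  ; effect = λ _ m → m [ dst ≔ c ] ; sound = λ _ _ _ → refl }
loadᵒ dst a = record { instruction = load dst a
  ; effect = λ _ m → m [ dst ≔ m (m a) ] ; sound = λ _ _ _ → refl }
storeᵒ dst a = record { instruction = store dst a
  ; effect = λ _ m → m [ m dst ≔ m a ] ; sound = λ _ _ _ → refl }

addᵒ subᵒ neighbourᵒ : (dst a b : ℕ) → Op
addᵒ dst a b = record { instruction = add dst a b
  ; effect = λ _ m → m [ dst ≔ m a + m b ] ; sound = λ _ _ _ → refl }
subᵒ dst a b = record { instruction = sub dst a b
  ; effect = λ _ m → m [ dst ≔ m a ∸ m b ] ; sound = λ _ _ _ → refl }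
neighbourᵒ dst a b = record { instruction = neighbour P dst a b
  ; effect = λ G m → m [ dst ≔ entry G P (m a) (m b) ] ; sound = λ _ _ _ → refl }

getDegreeᵒ : (dst : ℕ) → Op
getDegreeᵒ dst = record { instruction = getDegree dst
  ; effect = λ G m → m [ dst ≔ d G ] ; sound = λ _ _ _ → refl }

infixr 5 _▸_

-- A loop-free program in tree form. Its control state may remember the
-- outcome of every test made so far.
data Tree : Set where
  stop   : Tree
  _▸_    : Op → Tree → Tree
  ifZero : (a : ℕ) → Tree → Tree → Tree

module _ {n} (G : Input n) where

  -- The number of steps from a memory until the tree stops, and the memory
  -- at that time.
  steps : Tree → Memory → ℕ
  steps stop           m = 0
  steps (i ▸ t)        m = suc (steps t (effect i G m))
  steps (ifZero a t e) m = suc (if m a ≡ᵇ 0 then steps t m else steps e m)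

  final : Tree → Memory → Memory
  final stop           m = m
  final (i ▸ t)        m = final t (effect i G m)
  final (ifZero a t e) m = if m a ≡ᵇ 0 then final t m else final e m

-- The code of a tree when its first instruction is at the given address. The
-- branch for zero is placed after the other one.
compile : ℕ → Tree → Program
compile o stop           = halt ∷ []
compile o (i ▸ t)        = instruction i ∷ compile (suc o) t
compile o (ifZero a t e) = jumpZero a (suc o + length (compile (suc o) e)) ∷
  compile (suc o) e ++ compile (suc o + length (compile (suc o) e)) t

-- The program holds the code of the tree at the given address.
data Loaded (prog : Program) : ℕ → Tree → Set where
  stop   : ∀ {o} → fetch prog o ≡ halt → Loaded prog o stop
  op     : ∀ {o i t} → fetch prog o ≡ instruction i → Loaded prog (suc o) t →
           Loaded prog o (i ▸ t)
  ifZero : ∀ {o a l t e} → fetch prog o ≡ jumpZero a l → Loaded prog l t →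
           Loaded prog (suc o) e → Loaded prog o (ifZero a t e)

loaded-runs : ∀ {n} (G : Input n) {prog o t} m → Loaded prog o t →
              Runs G prog (o , m) (steps G t m) (final G t m)
loaded-runs G {o = o} m (stop eq) = halted (cong (λ i → execute G i (o , m)) eq)
loaded-runs G {o = o} m (op {i = i} eq l) =
  step (trans (cong (λ i → execute G i (o , m)) eq) (sound i G o m))
       (loaded-runs G (effect i G m) l)
loaded-runs G {prog} {o} m (ifZero {a = a} {l} {t} {e} eq lt le) =
  step (cong (λ i → execute G i (o , m)) eq) (branch (m a ≡ᵇ 0))
  where
  branch : ∀ b → Runs G prog ((if b then l else suc o) , m)
    (if b then steps G t m else steps G e m) (if b then final G t m else final G e m)
  branch true  = loaded-runs G m lt
  branch false = loaded-runs G m le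

fetch-++ : ∀ pre {i rest} → fetch (pre ++ i ∷ rest) (length pre) ≡ i
fetch-++ []        = refl
fetch-++ (_ ∷ pre) = fetch-++ pre

length-∷ʳ′ : ∀ {A : Set} (xs : List A) {x} → suc (length xs) ≡ length (xs ∷ʳ x)
length-∷ʳ′ xs = sym (trans (length-++ xs) (+-comm (length xs) 1))

compile-loaded : ∀ {prog o} pre t post → prog ≡ pre ++ compile o t ++ post →
                 o ≡ length pre → Loaded prog o t
compile-loaded pre stop post refl refl = stop (fetch-++ pre)
compile-loaded pre (i ▸ t) post refl refl = op (fetch-++ pre)
  (compile-loaded (pre ∷ʳ instruction i) t post (sym (∷ʳ-++ pre _ _)) (length-∷ʳ′ pre))
compile-loaded {o = o} pre (ifZero a t e) post refl refl = ifZero (fetch-++ pre)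
  (compile-loaded ((pre ∷ʳ jz) ++ ce) t post
    (trans layout (sym (++-assoc (pre ∷ʳ jz) ce (ct ++ post))))
    (trans (cong (_+ length ce) (length-∷ʳ′ pre)) (sym (length-++ (pre ∷ʳ jz)))))
  (compile-loaded (pre ∷ʳ jz) e (ct ++ post) layout (length-∷ʳ′ pre))
  where
  ce = compile (suc o) e
  jz = jumpZero a (suc o + length ce)
  ct = compile (suc o + length ce) t
  layout : pre ++ (jz ∷ ce ++ ct) ++ post ≡ (pre ∷ʳ jz) ++ ce ++ ct ++ post
  layout = trans (cong (λ r → pre ++ jz ∷ r) (++-assoc ce ct post))
                 (sym (∷ʳ-++ pre jz _))

compile-runs : ∀ {n} (G : Input n) t m →
               Runs G (compile 0 t ++ []) (0 , m) (steps G t m) (final G t m)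
compile-runs G t m = loaded-runs G m (compile-loaded [] t [] refl refl)

-- Randomized trees and their derandomization

-- A tree that may also choose uniformly among k continuations, at no cost.
data Code : Set where
  stop   : Code
  _▸_    : Op → Code → Code
  ifZero : (a : ℕ) → Code → Code → Code
  rand   : ∀ k → .{{NonZero k}} → (Fin k → Code) → Code

Solves : ∀ {n} → Input n → Memory → Set
Solves G m = IsPerfectMatching (graph G) (matchingIn m)

-- Within G C m b: from memory m, whatever the random choices, C ends with a
-- perfect matching of G, and the expected number of steps is at most b. The
-- bounds are natural numbers, and a bound for a random choice is any number
-- that is at least the average of the bounds for its outcomes.
Within : ∀ {n} → Input n → Code → Memory → ℕ → Set
Within G stop           m b       = Solves G m
Within G (i ▸ C)        m zero    = ⊥
Within G (i ▸ C)        m (suc b) = Within G C (effect i G m) b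
Within G (ifZero a C E) m zero    = ⊥
Within G (ifZero a C E) m (suc b) =
  if m a ≡ᵇ 0 then Within G C m b else Within G E m b
Within G (rand k C)     m b       =
  Σ[ x ∈ (Fin k → ℕ) ] (∀ j → Within G (C j) m (x j)) × sum x ≤ k * b

-- An input that reaches C with the given memory, its weight, and a bound on
-- the expected number of steps of C.
record Sample {n} (C : Code) : Set where
  constructor sample
  field
    weight bound : ℕ
    input        : Input n
    memory       : Memory
    within       : Within input C memory bound

module _ {n : ℕ} where

  -- The weighted sums of the bounds, and of the times taken by a tree.
  budget : ∀ {C} → List (Sample {n} C) → ℕ
  budget []       = 0
  budget (s ∷ ss) = Sample.weight s * Sample.bound s + budget ss

  cost : ∀ {C} → Tree → List (Sample {n} C) → ℕ
  cost D []       = 0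
  cost D (s ∷ ss) =
    Sample.weight s * steps (Sample.input s) D (Sample.memory s) + cost D ss

  -- The samples after an operation, after a test with either outcome, and
  -- after a random choice.
  after : ∀ {i C} → List (Sample {n} (i ▸ C)) → List (Sample {n} C)
  after [] = []
  after {i} (sample w (suc b) G m g ∷ ss) = sample w b G (effect i G m) g ∷ after ss

  zeros : ∀ {a C E} → List (Sample {n} (ifZero a C E)) → List (Sample {n} C)
  zeros [] = []
  zeros {a} (sample w (suc b) G m g ∷ ss) with m a ≡ᵇ 0
  ... | true  = sample w b G m g ∷ zeros ss
  ... | false = zeros ss

  nonzeros : ∀ {a C E} → List (Sample {n} (ifZero a C E)) → List (Sample {n} E)
  nonzeros [] = []
  nonzeros {a} (sample w (suc b) G m g ∷ ss) with m a ≡ᵇ 0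
  ... | true  = nonzeros ss
  ... | false = sample w b G m g ∷ nonzeros ss

  choose : ∀ {k} .{{_ : NonZero k}} {C : Fin k → Code} →
           List (Sample {n} (rand k C)) → ∀ j → List (Sample {n} (C j))
  choose [] j = []
  choose (sample w b G m (x , g , _) ∷ ss) j = sample w (x j) G m (g j) ∷ choose ss j

  totalWeight : ∀ {C} → List (Sample {n} C) → ℕ
  totalWeight []       = 0
  totalWeight (s ∷ ss) = Sample.weight s + totalWeight ss

  private
    regroup : ∀ w b x y → w * suc b + (x + y) ≡ (w + x) + (w * b + y)
    regroup = solve 4 (λ w b x y → w :* (con 1 :+ b) :+ (x :+ y) := (w :+ x) :+ (w :* b :+ y)) refl
      where open +-*-Solver

  budget-after : ∀ {i C} (ss : List (Sample (i ▸ C))) →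
                 budget ss ≡ totalWeight ss + budget (after ss)
  budget-after [] = refl
  budget-after (sample w (suc b) G m g ∷ ss) rewrite budget-after ss = regroup w b _ _

  cost-after : ∀ {i C} D (ss : List (Sample (i ▸ C))) →
               cost (i ▸ D) ss ≡ totalWeight ss + cost D (after ss)
  cost-after D [] = refl
  cost-after D (sample w (suc b) G m g ∷ ss) rewrite cost-after D ss = regroup w _ _ _

  private
    regroup₁ : ∀ w b x y z → w * suc b + (x + (y + z)) ≡ (w + x) + ((w * b + y) + z)
    regroup₁ = solve 5 (λ w b x y z → w :* (con 1 :+ b) :+ (x :+ (y :+ z))
                                   := (w :+ x) :+ ((w :* b :+ y) :+ z)) refl
      where open +-*-Solver

    regroup₂ : ∀ w b x y z → w * suc b + (x + (y + z)) ≡ (w + x) + (y + (w * b + z))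
    regroup₂ = solve 5 (λ w b x y z → w :* (con 1 :+ b) :+ (x :+ (y :+ z))
                                   := (w :+ x) :+ (y :+ (w :* b :+ z))) refl
      where open +-*-Solver

  budget-split : ∀ {a C E} (ss : List (Sample (ifZero a C E))) →
                 budget ss ≡ totalWeight ss + (budget (zeros ss) + budget (nonzeros ss))
  budget-split [] = refl
  budget-split {a} (sample w (suc b) G m g ∷ ss) with m a ≡ᵇ 0
  ... | true  rewrite budget-split ss = regroup₁ w b _ _ _
  ... | false rewrite budget-split ss = regroup₂ w b _ (budget (zeros ss)) _

  cost-split : ∀ {a C E} D F (ss : List (Sample (ifZero a C E))) →
               cost (ifZero a D F) ss ≡
               totalWeight ss + (cost D (zeros ss) + cost F (nonzeros ss))
  cost-split D F [] = refl
  cost-split {a} D F (sample w (suc b) G m g ∷ ss) with m a ≡ᵇ 0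
  ... | true  rewrite cost-split D F ss = regroup₁ w _ _ _ _
  ... | false rewrite cost-split D F ss = regroup₂ w _ _ (cost D (zeros ss)) _

  budget-choose : ∀ {k} .{{_ : NonZero k}} {C : Fin k → Code} (ss : List (Sample (rand k C))) →
                  sum (λ j → budget (choose ss j)) ≤ k * budget ss
  budget-choose {k} [] = ≤-reflexive (trans (sum-replicate-zero k) (sym (*-zeroʳ k)))
  budget-choose {k} (sample w b G m (x , g , avg) ∷ ss) = begin
    sum (λ j → w * x j + budget (choose ss j))        ≡⟨ ∑-distrib-+ (λ j → w * x j) _ ⟩
    sum (λ j → w * x j) + sum (λ j → budget (choose ss j))
      ≡⟨ cong (_+ _) (*-distribˡ-sum w x) ⟨
    w * sum x + sum (λ j → budget (choose ss j))      ≤⟨ +-mono-≤ (*-monoʳ-≤ w avg) (budget-choose ss) ⟩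
    w * (k * b) + k * budget ss
      ≡⟨ solve 4 (λ w k b r → w :* (k :* b) :+ k :* r := k :* (w :* b :+ r)) refl w k b (budget ss) ⟩
    k * (w * b + budget ss)                           ∎
    where open ≤-Reasoning
          open +-*-Solver

-- Some value is at most the average.
below-average : ∀ k .{{_ : NonZero k}} (f : Fin k → ℕ) {b} → sum f ≤ k * b → ∃ λ j → f j ≤ b
below-average (suc k) = go k
  where
  go : ∀ k (f : Fin (suc k) → ℕ) {b} → sum f ≤ suc k * b → ∃ λ j → f j ≤ b
  go zero f {b} le = zero , subst₂ _≤_ (+-identityʳ (f zero)) (+-identityʳ b) le
  go (suc k) f {b} le with f zero ≤? b
  ... | yes p = zero , p
  ... | no ¬p with go k (f ∘ suc)
                     (+-cancelˡ-≤ b _ _ (≤-trans (+-monoˡ-≤ _ (<⇒≤ (≰⇒> ¬p))) le))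
  ...   | j , q = suc j , q

-- Yao's principle: fixing each random choice in turn to one that is no worse
-- than the average for the weighted inputs that reach it gives a deterministic
-- tree.
derandomize : ∀ {n} C (ss : List (Sample {n} C)) → Σ[ D ∈ Tree ]
  (∀ G m b → Within {n} G C m b → Solves G (final G D m)) × cost D ss ≤ budget ss
derandomize {n} stop ss = stop , (λ G m b g → g) , stop-free ss
  where
  stop-free : ∀ (ss : List (Sample {n} stop)) → cost stop ss ≤ budget ss
  stop-free []       = z≤n
  stop-free (s ∷ ss) = +-mono-≤ (*-monoʳ-≤ (Sample.weight s) z≤n) (stop-free ss)
derandomize {n} (i ▸ C) ss with derandomize C (after ss)
... | D , correct , cheap = i ▸ D , correct′ , cheap′
  where
  correct′ : ∀ G m b → Within {n} G (i ▸ C) m b → Solves G (final G (i ▸ D) m)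
  correct′ G m (suc b) g = correct G (effect i G m) b g
  cheap′ : cost (i ▸ D) ss ≤ budget ss
  cheap′ rewrite budget-after ss | cost-after D ss = +-monoʳ-≤ (totalWeight ss) cheap
derandomize {n} (ifZero a C E) ss with derandomize C (zeros ss) | derandomize E (nonzeros ss)
... | D , correctD , cheapD | F , correctF , cheapF = ifZero a D F , correct′ , cheap′
  where
  correct′ : ∀ G m b → Within {n} G (ifZero a C E) m b → Solves G (final G (ifZero a D F) m)
  correct′ G m (suc b) g with m a ≡ᵇ 0
  ... | true  = correctD G m b g
  ... | false = correctF G m b g
  cheap′ : cost (ifZero a D F) ss ≤ budget ss
  cheap′ rewrite budget-split ss | cost-split D F ss =
    +-monoʳ-≤ (totalWeight ss) (+-mono-≤ cheapD cheapF)
derandomize {n} (rand k C) ss with below-average k _ (budget-choose ss)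
... | j , best with derandomize (C j) (choose ss j)
...   | D , correct , cheap =
        D , (λ G m b (x , g , _) → correct G m (x j) (g j)) ,
        ≤-trans (≤-reflexive (sym (same ss))) (≤-trans cheap best)
  where
  same : ∀ (ss : List (Sample {n} (rand k C))) → cost D (choose ss j) ≡ cost D ss
  same []       = refl
  same (s ∷ ss) = cong (_ +_) (same ss)

-- Finite sums

sum-mono-≤ : ∀ {k} {f g : Fin k → ℕ} → (∀ i → f i ≤ g i) → sum f ≤ sum g
sum-mono-≤ {zero}  f≤g = z≤n
sum-mono-≤ {suc k} f≤g = +-mono-≤ (f≤g zero) (sum-mono-≤ (f≤g ∘ suc))

sum-const : ∀ k c → sum {k} (λ _ → c) ≡ k * c
sum-const zero    c = refl
sum-const (suc k) c = cong (c +_) (sum-const k c)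

term≤sum : ∀ {k} (f : Fin k → ℕ) i → f i ≤ sum f
term≤sum f zero    = m≤m+n _ _
term≤sum f (suc i) = ≤-trans (term≤sum (f ∘ suc) i) (m≤n+m _ _)

sum-injective : ∀ {k n} (g : Fin k → Fin n) → Injective _≡_ _≡_ g →
                ∀ f → sum (f ∘ g) ≤ sum f
sum-injective {zero}  g inj f = z≤n
sum-injective {suc k} {zero} g inj f with () ← g zero
sum-injective {suc k} {suc n} g inj f = begin
  f (g zero) + sum (f ∘ g ∘ suc)
    ≡⟨ cong (f (g zero) +_) (sum-cong-≗ (λ r → cong f (sym (punchIn-punchOut (apart r))))) ⟩
  f (g zero) + sum ((f ∘ punchIn (g zero)) ∘ h)
    ≤⟨ +-monoʳ-≤ _ (sum-injective h h-injective (f ∘ punchIn (g zero))) ⟩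
  f (g zero) + sum (f ∘ punchIn (g zero))        ≡⟨ sum-remove {i = g zero} f ⟨
  sum f                                          ∎
  where
  open ≤-Reasoning
  apart : ∀ r → g zero ≢ g (suc r)
  apart r eq with () ← inj eq
  h : Fin k → Fin n
  h r = punchOut (apart r)
  h-injective : Injective _≡_ _≡_ h
  h-injective {r} {r′} eq = suc-injective (inj (punchOut-injective (apart r) (apart r′) eq))

indicator : Bool → ℕ
indicator b = if b then 1 else 0

∣tabulate∣ : ∀ {n} (f : Fin n → Bool) → ∣ Vec.tabulate f ∣ ≡ sum (indicator ∘ f)
∣tabulate∣ {zero}  f = refl
∣tabulate∣ {suc n} f with f zero
... | true  = cong suc (∣tabulate∣ (f ∘ suc))
... | false = ∣tabulate∣ (f ∘ suc)

-- If S t is the total of a quantity at time t, of which x t is lost and at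
-- most c is gained in one step, then what is lost is bounded by what was ever there.
telescope : ∀ (S x : ℕ → ℕ) c → (∀ t → S (suc t) + x t ≤ c + S t) →
            ∀ T → S T + sum {T} (x ∘ toℕ) ≤ T * c + S 0
telescope S x c h zero    = ≤-reflexive (+-identityʳ (S 0))
telescope S x c h (suc T) = begin
  S (suc T) + (x 0 + sum {T} (x ∘ suc ∘ toℕ))
    ≡⟨ solve 3 (λ a b c → a :+ (b :+ c) := (a :+ c) :+ b) refl (S (suc T)) (x 0) _ ⟩
  (S (suc T) + sum {T} (x ∘ suc ∘ toℕ)) + x 0
    ≤⟨ +-monoˡ-≤ (x 0) (telescope (S ∘ suc) (x ∘ suc) c (h ∘ suc) T) ⟩
  (T * c + S 1) + x 0    ≡⟨ +-assoc (T * c) (S 1) (x 0) ⟩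
  T * c + (S 1 + x 0)    ≤⟨ +-monoʳ-≤ (T * c) (h 0) ⟩
  T * c + (c + S 0)      ≡⟨ solve 3 (λ a b c → a :+ (b :+ c) := (b :+ a) :+ c) refl (T * c) c (S 0) ⟩
  (c + T * c) + S 0      ∎
  where open ≤-Reasoning
        open +-*-Solver

-- The random walk

-- X lists the vertices of P left unmatched by M, where M q is the partner of
-- q: every vertex of P occurs exactly once among the partners and in X. This
-- is expressed by summing an arbitrary function over P.
record Unmatched {n k} (M : Fin n → Maybe (Fin n)) (X : Fin k → Fin n) : Set where
  constructor balanced
  field balance : ∀ f → sum (λ q → maybe′ f 0 (M q)) + sum (f ∘ X) ≡ sum f
open Unmatched

degree-nonZero : ∀ {n} (G : Input n) → NonZero (d G)
degree-nonZero G = >-nonZero (proj₁ (regular G))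

array-edge : ∀ {n} (G : Input n) u r → Edge (graph G) u (array G P u r)
array-edge G u r = Equivalence.from (lists G P u _) (r , refl)

-- A function on Q summed over all arcs leaving P: each vertex of Q is the end
-- of d of them.
sum-arcs : ∀ {n} (G : Input n) (f : Fin n → ℕ) →
           sum (λ u → sum (λ r → f (array G P u r))) ≤ d G * sum f
sum-arcs G f = begin
  sum (λ u → sum (λ r → f (array G P u r)))           ≤⟨ sum-mono-≤ from-vertex ⟩
  sum (λ u → sum (λ q → indicator (graph G u q) * f q))  ≡⟨ ∑-comm (λ u q → indicator (graph G u q) * f q) ⟩
  sum (λ q → sum (λ u → indicator (graph G u q) * f q))
    ≡⟨ sum-cong-≗ (λ q → *-distribʳ-sum (f q) (λ u → indicator (graph G u q))) ⟨
  sum (λ q → sum (λ u → indicator (graph G u q)) * f q)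
    ≡⟨ sum-cong-≗ (λ q → cong (_* f q) (trans (sym (∣tabulate∣ (λ u → graph G u q))) (proj₂ (regular G) Q q))) ⟩
  sum (λ q → d G * f q)                               ≡⟨ *-distribˡ-sum (d G) f ⟨
  d G * sum f                                         ∎
  where
  open ≤-Reasoning
  from-vertex : ∀ u → sum (λ r → f (array G P u r)) ≤ sum (λ q → indicator (graph G u q) * f q)
  from-vertex u = begin
    sum (λ r → f (array G P u r))
      ≡⟨ sum-cong-≗ (λ r → trans (sym (*-identityˡ _))
           (cong (λ b → indicator b * f (array G P u r)) (sym (array-edge G u r)))) ⟩
    sum (λ r → indicator (graph G u (array G P u r)) * f (array G P u r))
      ≤⟨ sum-injective (array G P u) (injective G P u) (λ q → indicator (graph G u q) * f q) ⟩
    sum (λ q → indicator (graph G u q) * f q) ∎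

module Walk {n} (G : Input n) (M : Fin n → Maybe (Fin n)) where

  private instance
    d≢0 = degree-nonZero G

  -- The walk at a vertex u of P picks a random neighbour; if that is
  -- unmatched, the walk ends, and otherwise it moves to its partner.
  -- potential K B t u bounds the expected cost of the walk from u, when a
  -- step costs at most K - 1 and the walk is abandoned after t steps, at
  -- cost B. The remaining unit of K pays for rounding the average down.
  potential : (K B t : ℕ) → Fin n → ℕ
  potential K B zero    u = B
  potential K B (suc t) u =
    K + sum (λ r → maybe′ (potential K B t) 0 (M (array G P u r))) / d G

  module _ {k} {X : Fin k → Fin n} (unmatched : Unmatched M X) (K B : ℕ) where

    -- Each vertex of Q has d neighbours, so summing the recurrence over P
    -- gives on the right the sum over the matched vertices only.
    potential-step : ∀ t → sum (potential K B (suc t)) + sum (potential K B t ∘ X) ≤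
                           n * K + sum (potential K B t)
    potential-step t = begin
      sum (potential K B (suc t)) + sum (φ ∘ X)     ≤⟨ +-monoˡ-≤ _ (*-cancelˡ-≤ (d G) scaled) ⟩
      n * K + sum (λ q → φ̂ (M q)) + sum (φ ∘ X)     ≡⟨ +-assoc (n * K) _ _ ⟩
      n * K + (sum (λ q → φ̂ (M q)) + sum (φ ∘ X))   ≡⟨ cong (n * K +_) (balance unmatched φ) ⟩
      n * K + sum φ                                 ∎
      where
      open ≤-Reasoning
      φ = potential K B t
      φ̂ = maybe′ φ 0
      out : Fin n → ℕ
      out u = sum (λ r → φ̂ (M (array G P u r)))
      scaled : d G * sum (potential K B (suc t)) ≤ d G * (n * K + sum (λ q → φ̂ (M q)))
      scaled = begin
        d G * sum (λ u → K + out u / d G)         ≡⟨ *-distribˡ-sum (d G) (λ u → K + out u / d G) ⟩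
        sum (λ u → d G * (K + out u / d G))       ≤⟨ sum-mono-≤ (λ u → begin
            d G * (K + out u / d G)                  ≡⟨ *-distribˡ-+ (d G) K _ ⟩
            d G * K + d G * (out u / d G)            ≡⟨ cong (d G * K +_) (*-comm (d G) _) ⟩
            d G * K + out u / d G * d G              ≤⟨ +-monoʳ-≤ (d G * K) (m/n*n≤m (out u) (d G)) ⟩
            d G * K + out u                          ∎) ⟩
        sum (λ u → d G * K + out u)               ≡⟨ ∑-distrib-+ {n} (λ _ → d G * K) out ⟩
        sum {n} (λ _ → d G * K) + sum out         ≤⟨ +-mono-≤ (≤-reflexive (sum-const n (d G * K))) (sum-arcs G (φ̂ ∘ M)) ⟩
        n * (d G * K) + d G * sum (φ̂ ∘ M)
          ≡⟨ solve 4 (λ n d K s → n :* (d :* K) :+ d :* s := d :* (n :* K :+ s)) refl n (d G) K _ ⟩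
        d G * (n * K + sum (φ̂ ∘ M))               ∎
        where open +-*-Solver

    -- If T is at least B, then the average over the lengths t < T of the
    -- total potential of the unmatched vertices has a bound without B.
    potential-average : ∀ T → B ≤ T →
      sum {T} (λ t → sum (potential K B (toℕ t) ∘ X)) ≤ T * (n * suc K)
    potential-average T B≤T = begin
      sum {T} (x ∘ toℕ)            ≤⟨ m≤n+m _ _ ⟩
      S T + sum {T} (x ∘ toℕ)      ≤⟨ telescope S x (n * K) potential-step T ⟩
      T * (n * K) + S 0            ≡⟨ cong (T * (n * K) +_) (sum-const n B) ⟩
      T * (n * K) + n * B          ≤⟨ +-monoʳ-≤ (T * (n * K)) (*-monoʳ-≤ n B≤T) ⟩
      T * (n * K) + n * T          ≡⟨ solve 3 (λ T n K → T :* (n :* K) :+ n :* T := T :* (n :* (con 1 :+ K))) refl T n K ⟩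
      T * (n * suc K)              ∎
      where
      open ≤-Reasoning
      open +-*-Solver
      S x : ℕ → ℕ
      S t = sum (potential K B t)
      x t = sum (potential K B t ∘ X)

  -- Whether the walk from u with the given choices reaches an unmatched
  -- vertex of Q.
  escapes : ∀ {t} → Vec (Fin (d G)) t → Fin n → Bool
  escapes []       u = false
  escapes (r ∷ rs) u = maybe′ (escapes rs) true (M (array G P u r))

  -- If no walk of length t from u escapes, then all of them make t steps, each
  -- at cost 1.
  trapped-potential : ∀ t u → (∀ (rs : Vec (Fin (d G)) t) → escapes rs u ≢ true) →
                      t ≤ potential 1 0 t u
  trapped-potential zero    u trapped = z≤n
  trapped-potential (suc t) u trapped = s≤s (begin
    t                      ≡⟨ m*n/n≡m t (d G) ⟨
    t * d G / d G          ≤⟨ /-monoˡ-≤ (d G) (begin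
       t * d G                  ≡⟨ *-comm t (d G) ⟩
       d G * t                  ≡⟨ sum-const (d G) t ⟨
       sum {d G} (λ _ → t)      ≤⟨ sum-mono-≤ arc ⟩
       sum (λ r → maybe′ (potential 1 0 t) 0 (M (array G P u r))) ∎) ⟩
    sum (λ r → maybe′ (potential 1 0 t) 0 (M (array G P u r))) / d G ∎)
    where
    open ≤-Reasoning
    arc : ∀ r → t ≤ maybe′ (potential 1 0 t) 0 (M (array G P u r))
    arc r with M (array G P u r) in eq
    ... | nothing = contradiction (cong (maybe′ _ true) eq) (trapped (r ∷ Vec.replicate t r))
    ... | just v  = trapped-potential t v (λ rs esc →
                      trapped (r ∷ rs) (trans (cong (maybe′ (escapes rs) true) eq) esc))

  potential-mono : ∀ K t u → potential K 0 t u ≤ potential K 0 (suc t) u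
  potential-mono K zero    u = z≤n
  potential-mono K (suc t) u = +-monoʳ-≤ K (/-monoˡ-≤ (d G) (sum-mono-≤ arc))
    where
    arc : ∀ r → maybe′ (potential K 0 t) 0 (M (array G P u r)) ≤
                maybe′ (potential K 0 (suc t)) 0 (M (array G P u r))
    arc r with M (array G P u r)
    ... | nothing = z≤n
    ... | just v  = potential-mono K t v

  -- Some walk of length n + 1 escapes: otherwise its potential exceeds the
  -- bound n on the total potential of the unmatched vertices.
  not-trapped : ∀ {k} {X : Fin k → Fin n} → Unmatched M X → ∀ i →
                ¬ (∀ (rs : Vec (Fin (d G)) (suc n)) → escapes rs (X i) ≢ true)
  not-trapped {X = X} unmatched i trapped = 1+n≰n (begin
    suc n                                  ≤⟨ trapped-potential (suc n) (X i) trapped ⟩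
    potential 1 0 (suc n) (X i)            ≤⟨ term≤sum (potential 1 0 (suc n) ∘ X) i ⟩
    sum (potential 1 0 (suc n) ∘ X)        ≤⟨ +-cancelˡ-≤ (sum (potential 1 0 (suc n))) _ _ (begin
      sum (potential 1 0 (suc n)) + sum (potential 1 0 (suc n) ∘ X)
        ≤⟨ +-monoˡ-≤ _ (sum-mono-≤ (potential-mono 1 (suc n))) ⟩
      sum (potential 1 0 (suc (suc n))) + sum (potential 1 0 (suc n) ∘ X)
        ≤⟨ potential-step unmatched 1 0 (suc n) ⟩
      n * 1 + sum (potential 1 0 (suc n))  ≡⟨ cong (_+ sum (potential 1 0 (suc n))) (*-identityʳ n) ⟩
      n + sum (potential 1 0 (suc n))      ≡⟨ +-comm n _ ⟩
      sum (potential 1 0 (suc n)) + n      ∎) ⟩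
    n                                      ∎)
    where open ≤-Reasoning

allVecs : ∀ k t → List (Vec (Fin k) t)
allVecs k zero    = [] ∷ []
allVecs k (suc t) = cartesianProductWith _∷_ (allFin k) (allVecs k t)

∈-allVecs : ∀ {k t} (rs : Vec (Fin k) t) → rs ∈ allVecs k t
∈-allVecs []       = here refl
∈-allVecs (r ∷ rs) = ∈-cartesianProductWith⁺ _∷_ (∈-allFin r) (∈-allVecs rs)

some-walk-escapes : ∀ {n k} (G : Input n) {M} {X : Fin k → Fin n} → Unmatched M X → ∀ i →
  Any (λ rs → Walk.escapes G M rs (X i) ≡ true) (allVecs (d G) (suc n))
some-walk-escapes G {M} {X} unmatched i
  with any? (λ rs → Walk.escapes G M rs (X i) ≟ᵇ true) (allVecs (d G) _)
... | yes found = found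
... | no ¬found = contradiction
      (λ rs esc → ¬found (lose (∈-allVecs rs) esc)) (Walk.not-trapped G M unmatched i)

-- Memory layout and symbolic execution

≡ᵇ-refl : ∀ a → (a ≡ᵇ a) ≡ true
≡ᵇ-refl zero    = refl
≡ᵇ-refl (suc a) = ≡ᵇ-refl a

≢⇒≡ᵇ : ∀ {a b} → a ≢ b → (a ≡ᵇ b) ≡ false
≢⇒≡ᵇ {zero}  {zero}  a≢b = contradiction refl a≢b
≢⇒≡ᵇ {zero}  {suc b} a≢b = refl
≢⇒≡ᵇ {suc a} {zero}  a≢b = refl
≢⇒≡ᵇ {suc a} {suc b} a≢b = ≢⇒≡ᵇ (a≢b ∘ cong suc)

+-cancelˡ-≡ᵇ : ∀ k a b → (k + a ≡ᵇ k + b) ≡ (a ≡ᵇ b)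
+-cancelˡ-≡ᵇ zero    a b = refl
+-cancelˡ-≡ᵇ (suc k) a b = +-cancelˡ-≡ᵇ k a b

-- The cells in use: for each vertex of P a pointer, which finally is its
-- partner, for each vertex of Q its mate, and some registers.
data Cell (n : ℕ) : Set where
  pointer mate : Fin n → Cell n
  reg          : ℕ → Cell n

addr : ∀ {n} → Cell n → ℕ
addr     (pointer u) = toℕ u
addr {n} (mate q)    = n + toℕ q
addr {n} (reg i)     = n + n + i

_≈ᵇ_ : ∀ {n} → Cell n → Cell n → Bool
pointer u ≈ᵇ pointer v = toℕ u ≡ᵇ toℕ v
mate p    ≈ᵇ mate q    = toℕ p ≡ᵇ toℕ q
reg i     ≈ᵇ reg j     = i ≡ᵇ j
_         ≈ᵇ _         = false

addr-≈ᵇ : ∀ {n} (b c : Cell n) → (addr b ≡ᵇ addr c) ≡ (b ≈ᵇ c)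
addr-≈ᵇ {n} (pointer u) (pointer v) = refl
addr-≈ᵇ {n} (pointer u) (mate q)    = ≢⇒≡ᵇ (<⇒≢ (<-≤-trans (toℕ<n u) (m≤m+n n _)))
addr-≈ᵇ {n} (pointer u) (reg i)     =
  ≢⇒≡ᵇ (<⇒≢ (<-≤-trans (toℕ<n u) (≤-trans (m≤m+n n n) (m≤m+n (n + n) i))))
addr-≈ᵇ {n} (mate q) (pointer u)    = ≢⇒≡ᵇ (>⇒≢ (<-≤-trans (toℕ<n u) (m≤m+n n _)))
addr-≈ᵇ {n} (mate p) (mate q)       = +-cancelˡ-≡ᵇ n _ _
addr-≈ᵇ {n} (mate q) (reg i)        =
  ≢⇒≡ᵇ (<⇒≢ (<-≤-trans (+-monoʳ-< n (toℕ<n q)) (m≤m+n (n + n) i)))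
addr-≈ᵇ {n} (reg i) (pointer u)     =
  ≢⇒≡ᵇ (>⇒≢ (<-≤-trans (toℕ<n u) (≤-trans (m≤m+n n n) (m≤m+n (n + n) i))))
addr-≈ᵇ {n} (reg i) (mate q)        =
  ≢⇒≡ᵇ (>⇒≢ (<-≤-trans (+-monoʳ-< n (toℕ<n q)) (m≤m+n (n + n) i)))
addr-≈ᵇ {n} (reg i) (reg j)         = +-cancelˡ-≡ᵇ (n + n) i j

-- The contents of the cells. Updates at distinct registers, or at cells of
-- different kinds, are seen through by computation.
Store : ℕ → Set
Store n = Cell n → ℕ

_⟨_≔_⟩ : ∀ {n} → Store n → Cell n → ℕ → Store n
(σ ⟨ b ≔ x ⟩) c = if b ≈ᵇ c then x else σ c

infixl 8 _⟨_≔_⟩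
infix 4 _∼_

_∼_ : ∀ {n} → Memory → Store n → Set
m ∼ σ = ∀ c → m (addr c) ≡ σ c

update-∼ : ∀ {n x y} {σ : Store n} m c → m ∼ σ → x ≡ y → (m [ addr c ≔ x ]) ∼ (σ ⟨ c ≔ y ⟩)
update-∼ m c m∼σ refl b rewrite addr-≈ᵇ c b with c ≈ᵇ b
... | true  = refl
... | false = m∼σ b

entry-array : ∀ {n} (G : Input n) u r → entry G P (toℕ u) (toℕ r) ≡ toℕ (array G P u r)
entry-array {n} G u r with toℕ u <? n | toℕ r <? d G
... | yes p | yes q = cong₂ (λ u r → toℕ (array G P u r)) (fromℕ<-toℕ u p) (fromℕ<-toℕ r q)
... | yes _ | no ¬q = contradiction (toℕ<n r) ¬q
... | no ¬p | _     = contradiction (toℕ<n u) ¬p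

Within-mono : ∀ {n} (G : Input n) C m {b c} → b ≤ c → Within G C m b → Within G C m c
Within-mono G stop           m le       g = g
Within-mono G (i ▸ C)        m (s≤s le) g = Within-mono G C (effect i G m) le g
Within-mono G (ifZero a C E) m (s≤s le) g with m a ≡ᵇ 0
... | true  = Within-mono G C m le g
... | false = Within-mono G E m le g
Within-mono G (rand k C)     m le (x , g , avg) =
  x , g , ≤-trans avg (*-monoʳ-≤ k le)

-- From any memory with the given contents, C finds a perfect matching within
-- b expected steps.
record Finds {n} (G : Input n) (C : Code) (σ : Store n) (b : ℕ) : Set where
  constructor finds
  field run : ∀ m → m ∼ σ → Within G C m b
open Finds

module _ {n} {G : Input n} where

  private
    r : ℕ → ℕ
    r i = addr {n} (reg i)

  Finds-mono : ∀ {C σ b c} → b ≤ c → Finds G C σ b → Finds G C σ c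
  Finds-mono {C} le f = finds λ m m∼σ → Within-mono G C m le (run f m m∼σ)

  -- Symbolic execution: each rule takes the equations that determine the
  -- values read, and replaces the store by the updated one.
  const-rule : ∀ {C σ b i x} → Finds G C (σ ⟨ reg i ≔ x ⟩) b →
               Finds G (constᵒ (r i) x ▸ C) σ (suc b)
  const-rule f = finds λ m m∼σ → run f _ (update-∼ m (reg _) m∼σ refl)

  add-rule : ∀ {C σ b i j k x} → σ (reg j) + σ (reg k) ≡ x →
             Finds G C (σ ⟨ reg i ≔ x ⟩) b → Finds G (addᵒ (r i) (r j) (r k) ▸ C) σ (suc b)
  add-rule {j = j} {k} eq f = finds λ m m∼σ → run f _ (update-∼ m (reg _) m∼σ
    (trans (cong₂ _+_ (m∼σ (reg j)) (m∼σ (reg k))) eq))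

  sub-rule : ∀ {C σ b i j k x} → σ (reg j) ∸ σ (reg k) ≡ x →
             Finds G C (σ ⟨ reg i ≔ x ⟩) b → Finds G (subᵒ (r i) (r j) (r k) ▸ C) σ (suc b)
  sub-rule {j = j} {k} eq f = finds λ m m∼σ → run f _ (update-∼ m (reg _) m∼σ
    (trans (cong₂ _∸_ (m∼σ (reg j)) (m∼σ (reg k))) eq))

  load-rule : ∀ {C σ b i j x} c → σ (reg j) ≡ addr c → σ c ≡ x →
              Finds G C (σ ⟨ reg i ≔ x ⟩) b → Finds G (loadᵒ (r i) (r j) ▸ C) σ (suc b)
  load-rule {j = j} c at eq f = finds λ m m∼σ → run f _ (update-∼ m (reg _) m∼σ
    (trans (cong m (trans (m∼σ (reg j)) at)) (trans (m∼σ c) eq)))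

  store-rule : ∀ {C σ b i j x} c → σ (reg i) ≡ addr c → σ (reg j) ≡ x →
               Finds G C (σ ⟨ c ≔ x ⟩) b → Finds G (storeᵒ (r i) (r j) ▸ C) σ (suc b)
  store-rule {C} {σ} {b} {i} {j} {x} c at eq f = finds λ m m∼σ →
    run f _ (subst (λ a → (m [ a ≔ m (r j) ]) ∼ (σ ⟨ c ≔ x ⟩)) (sym (trans (m∼σ (reg i)) at))
      (update-∼ m c m∼σ (trans (m∼σ (reg j)) eq)))

  neighbour-rule : ∀ {C σ b i j k} u s → σ (reg j) ≡ toℕ u → σ (reg k) ≡ toℕ s →
                   Finds G C (σ ⟨ reg i ≔ toℕ (array G P u s) ⟩) b →
                   Finds G (neighbourᵒ (r i) (r j) (r k) ▸ C) σ (suc b)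
  neighbour-rule {j = j} {k} u s eq eq′ f = finds λ m m∼σ → run f _ (update-∼ m (reg _) m∼σ
    (trans (cong₂ (entry G P) (trans (m∼σ (reg j)) eq) (trans (m∼σ (reg k)) eq′)) (entry-array G u s)))

  getDegree-rule : ∀ {C σ b i} → Finds G C (σ ⟨ reg i ≔ d G ⟩) b →
                   Finds G (getDegreeᵒ (r i) ▸ C) σ (suc b)
  getDegree-rule f = finds λ m m∼σ → run f _ (update-∼ m (reg _) m∼σ refl)

  zero-rule : ∀ {C E σ b i} → σ (reg i) ≡ 0 → Finds G C σ b →
              Finds G (ifZero (r i) C E) σ (suc b)
  zero-rule {C} {E} {b = b} {i} eq f = finds λ m m∼σ →
    subst (λ x → if x ≡ᵇ 0 then Within G C m b else Within G E m b)
          (sym (trans (m∼σ (reg i)) eq)) (run f m m∼σ)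

  suc-rule : ∀ {C E σ b i x} → σ (reg i) ≡ suc x → Finds G E σ b →
             Finds G (ifZero (r i) C E) σ (suc b)
  suc-rule {C} {E} {b = b} {i} eq f = finds λ m m∼σ →
    subst (λ x → if x ≡ᵇ 0 then Within G C m b else Within G E m b)
          (sym (trans (m∼σ (reg i)) eq)) (run f m m∼σ)

  -- The bound for a random choice is the average, rounded down, plus 1.
  rand-rule : ∀ {k} .{{_ : NonZero k}} {C : Fin k → Code} {σ a} (x : Fin k → ℕ) →
              (∀ j → Finds G (C j) σ (a + x j)) →
              Finds G (rand k C) σ (a + suc (sum x / k))
  rand-rule {k} {a = a} x f = finds λ m m∼σ → (λ j → a + x j) , (λ j → run (f j) m m∼σ) , (begin
    sum (λ j → a + x j)              ≡⟨ ∑-distrib-+ {k} (λ _ → a) x ⟩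
    sum {k} (λ _ → a) + sum x        ≡⟨ cong₂ _+_ (sum-const k a) (m≡m%n+[m/n]*n (sum x) k) ⟩
    k * a + (sum x % k + sum x / k * k)
      ≤⟨ +-monoʳ-≤ (k * a) (+-monoˡ-≤ _ (<⇒≤ (m%n<n (sum x) k))) ⟩
    k * a + (k + sum x / k * k)
      ≡⟨ solve 3 (λ k a y → k :* a :+ (k :+ y :* k) := k :* (a :+ (con 1 :+ y))) refl k a _ ⟩
    k * (a + suc (sum x / k))        ∎)
    where open ≤-Reasoning
          open +-*-Solver

-- The matching algorithm

-- The registers: the constants 1 and n; the current vertex of P; the number of
-- the arc taken, and the vertex of Q at its end; the address of the cell holding
-- the mate of that vertex, the content of that cell, and its new content.
one width cur arc nbr slot val new : ℕ
one   = 0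
width = 1
cur   = 2
arc   = 3
nbr   = 4
slot  = 5
val   = 6
new   = 7

module Algorithm (n : ℕ) where

  ρ : ℕ → ℕ
  ρ i = addr {n} (reg i)

  -- One step of the walk along the arc with the given number. The pointer of
  -- the current vertex is set to the neighbour taken.
  walkStep : ℕ → Code → Code → Code
  walkStep s S F =
    constᵒ (ρ arc) s ▸
    neighbourᵒ (ρ nbr) (ρ cur) (ρ arc) ▸
    storeᵒ (ρ cur) (ρ nbr) ▸
    addᵒ (ρ slot) (ρ width) (ρ nbr) ▸
    loadᵒ (ρ val) (ρ slot) ▸
    ifZero (ρ val) S (
    subᵒ (ρ cur) (ρ val) (ρ one) ▸
    F)

  -- Match the current vertex along its pointer, and continue with the vertex
  -- it displaces, for at most the given number of steps.
  augment : ℕ → Code → Code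
  augment zero    C = stop
  augment (suc ℓ) C =
    loadᵒ (ρ nbr) (ρ cur) ▸
    addᵒ (ρ slot) (ρ width) (ρ nbr) ▸
    loadᵒ (ρ val) (ρ slot) ▸
    addᵒ (ρ new) (ρ cur) (ρ one) ▸
    storeᵒ (ρ slot) (ρ new) ▸
    ifZero (ρ val) C (
    subᵒ (ρ cur) (ρ val) (ρ one) ▸
    augment ℓ C)

  augmentFrom : Fin n → ℕ → Code → Code
  augmentFrom u ℓ C = constᵒ (ρ cur) (toℕ u) ▸ augment ℓ C

  -- Record the partner of each vertex of P in its pointer.
  writeOut : List (Fin n) → Code
  writeOut []       = stop
  writeOut (q ∷ qs) =
    constᵒ (ρ nbr) (toℕ q) ▸
    constᵒ (ρ slot) (addr (mate q)) ▸
    loadᵒ (ρ val) (ρ slot) ▸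
    subᵒ (ρ cur) (ρ val) (ρ one) ▸
    storeᵒ (ρ cur) (ρ nbr) ▸
    writeOut qs

  module _ (D : ℕ) .{{_ : NonZero D}} where

    -- In the following, j counts the steps made so far, S is the continuation
    -- when the walk has reached an unmatched vertex, and F the continuation
    -- when it has been abandoned.
    randomWalk : (t j : ℕ) → (ℕ → Code) → Code → Code
    randomWalk zero    j S F = F
    randomWalk (suc t) j S F = rand D λ s →
      walkStep (toℕ s) (S (suc j)) (randomWalk t (suc j) S F)

    fixedWalk : ∀ {t} → Vec (Fin D) t → ℕ → (ℕ → Code) → Code → Code
    fixedWalk []       j S F = F
    fixedWalk (s ∷ ss) j S F = walkStep (toℕ s) (S (suc j)) (fixedWalk ss (suc j) S F)

    -- Walk from u along the given sequences, until an unmatched vertex is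
    -- reached.
    tryWalks : ∀ {t} → List (Vec (Fin D) t) → Fin n → (ℕ → Code) → Code
    tryWalks []         u S = stop
    tryWalks (ss ∷ sss) u S = constᵒ (ρ cur) (toℕ u) ▸ fixedWalk ss 0 S (tryWalks sss u S)

    -- The cost of trying all walks of length n + 1, including 7 per step for
    -- the augmentation along the last one.
    tryCost : ℕ
    tryCost = length (allVecs D (suc n)) * (1 + 7 * suc n) + 7 * suc n

    -- Match the vertices X, each time walking from a random one of them. The
    -- length of the walk is bounded by a random number; if it is exceeded,
    -- all walks of length n + 1 are tried.
    match : ∀ k → (Fin k → Fin n) → Code
    match zero    X = writeOut (allFin n)
    match (suc k) X = rand (suc tryCost) λ t → rand (suc k) λ i →
      constᵒ (ρ cur) (toℕ (X i)) ▸
      let continue = λ j → augmentFrom (X i) j (match k (removeAt X i)) in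
      randomWalk (toℕ t) 0 continue (tryWalks (allVecs D (suc n)) (X i) continue)

  -- Find the degree, which is known to exceed c and to be at most c + f, and
  -- start the algorithm for it.
  dispatch : (f c : ℕ) → Code
  dispatch zero    c = stop
  dispatch (suc f) c =
    subᵒ (ρ val) (ρ val) (ρ one) ▸
    ifZero (ρ val) (match (suc c) n id) (dispatch f (suc c))

  algorithm : Code
  algorithm =
    constᵒ (ρ one) 1 ▸
    constᵒ (ρ width) n ▸
    getDegreeᵒ (ρ val) ▸
    dispatch n 0

-- Correctness and expected time

-- The mate of a vertex of Q is stored plus 1, so that 0 means unmatched.
encode : ∀ {n} → Maybe (Fin n) → ℕ
encode = maybe′ (suc ∘ toℕ) 0

-- The store holds the matching M and the two constants.
record Holds {n} (M : Fin n → Maybe (Fin n)) (σ : Store n) : Set where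
  field
    mates  : ∀ q → σ (mate q) ≡ encode (M q)
    one≡   : σ (reg one) ≡ 1
    width≡ : σ (reg width) ≡ n
open Holds

-- π′ differs from π only at u, where it is v.
Moved : ∀ {n} (π : Fin n → ℕ) (u v : Fin n) (π′ : Fin n → ℕ) → Set
Moved π u v π′ = π′ u ≡ toℕ v × (∀ x → x ≢ u → π′ x ≡ π x)

module _ {n} {G : Input n} where

  open Algorithm n

  module _ {M : Fin n → Maybe (Fin n)} where

    walkStep-finds : ∀ {σ b S F} u s → let v = array G P u s in
      Holds M σ → σ (reg cur) ≡ toℕ u →
      (M v ≡ nothing → ∀ {σ′} → Holds M σ′ → Moved (σ ∘ pointer) u v (σ′ ∘ pointer) →
        Finds G S σ′ b) →
      (∀ y → M v ≡ just y → ∀ {σ′} → Holds M σ′ → Moved (σ ∘ pointer) u v (σ′ ∘ pointer) →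
        σ′ (reg cur) ≡ toℕ y → Finds G F σ′ b) →
      Finds G (walkStep (toℕ s) S F) σ (7 + b)
    walkStep-finds {σ} {b} {S} {F} u s h at-u done more =
      const-rule (neighbour-rule u s at-u refl (store-rule (pointer u) at-u refl
        (add-rule (cong (_+ toℕ v) (width≡ h)) (load-rule (mate v) refl (mates h v)
          (branch (M v) refl)))))
      where
      v = array G P u s
      store₁ : ℕ → Store n
      store₁ x = σ ⟨ reg arc ≔ toℕ s ⟩ ⟨ reg nbr ≔ toℕ v ⟩ ⟨ pointer u ≔ toℕ v ⟩
                   ⟨ reg slot ≔ n + toℕ v ⟩ ⟨ reg val ≔ x ⟩
      moved : Moved (σ ∘ pointer) u v (store₁ 0 ∘ pointer)
      moved = cong (if_then toℕ v else σ (pointer u)) (≡ᵇ-refl (toℕ u)) , λ x x≢u →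
        cong (if_then toℕ v else σ (pointer x)) (≢⇒≡ᵇ (x≢u ∘ sym ∘ toℕ-injective))
      branch : ∀ w → M v ≡ w →
        Finds G (ifZero (ρ val) S (subᵒ (ρ cur) (ρ val) (ρ one) ▸ F)) (store₁ (encode w)) (2 + b)
      branch nothing  eq = zero-rule refl (Finds-mono (n≤1+n b)
        (done eq (record { mates = mates h ; one≡ = one≡ h ; width≡ = width≡ h }) moved))
      branch (just y) eq = suc-rule refl (sub-rule {x = toℕ y} (cong (suc (toℕ y) ∸_) (one≡ h))
        (more y eq (record { mates = mates h ; one≡ = one≡ h ; width≡ = width≡ h }) moved refl))

-- Following the pointers from u and going from each vertex of Q reached to its
-- mate ends at an unmatched vertex of Q after at most ℓ rounds.
data Trail {n} (G : Input n) (M : Fin n → Maybe (Fin n)) (π : Fin n → ℕ) : Fin n → ℕ → Set where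
  end  : ∀ {u q ℓ} → π u ≡ toℕ q → Edge (graph G) u q → M q ≡ nothing → Trail G M π u (suc ℓ)
  next : ∀ {u q y ℓ} → π u ≡ toℕ q → Edge (graph G) u q → M q ≡ just y →
         Trail G M π y ℓ → Trail G M π u (suc ℓ)

-- A walk starting at s has made j steps and is now at u, and for every
-- possible continuation, the pointers finally give a trail from s. The
-- pointer π′ x can finally differ from π x only if x is visited again, and
-- then the last visit of x is the start of a trail.
record Leads {n} (G : Input n) (M : Fin n → Maybe (Fin n)) (π : Fin n → ℕ)
             (s u : Fin n) (j : ℕ) : Set where
  constructor leading
  field
    lead : ∀ π′ ℓ → (∀ x → π′ x ≡ π x ⊎ Trail G M π′ x ℓ) →
           Trail G M π′ u ℓ → Trail G M π′ s (j + ℓ)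
open Leads

module _ {n} {G : Input n} where

  Trail-mono : ∀ {M π u ℓ ℓ′} → ℓ ≤ ℓ′ → Trail G M π u ℓ → Trail G M π u ℓ′
  Trail-mono (s≤s le) (end eq e free)    = end eq e free
  Trail-mono (s≤s le) (next eq e m tail) = next eq e m (Trail-mono le tail)

  leads-start : ∀ {M π s} → Leads G M π s s 0
  leads-start = leading λ π′ ℓ others t → t

  leads-step : ∀ {M π π₁ s u v y j} → Leads G M π s u j → Moved π u v π₁ →
               Edge (graph G) u v → M v ≡ just y → Leads G M π₁ s y (suc j)
  leads-step {M} {π} {π₁} {s} {u} {v} {y} {j} leads (at-u , off-u) e m = leading walked
    where
    module _ π′ ℓ (others : ∀ x → π′ x ≡ π₁ x ⊎ Trail G M π′ x ℓ) (t : Trail G M π′ y ℓ) where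
      from-u : Trail G M π′ u (suc ℓ)
      from-u with others u
      ... | inj₁ eq = next (trans eq at-u) e m t
      ... | inj₂ t′ = Trail-mono (n≤1+n ℓ) t′
      others′ : ∀ x → π′ x ≡ π x ⊎ Trail G M π′ x (suc ℓ)
      others′ x with others x | x ≟ u
      ... | inj₂ t′ | _        = inj₂ (Trail-mono (n≤1+n ℓ) t′)
      ... | inj₁ eq | yes refl = inj₂ from-u
      ... | inj₁ eq | no x≢u   = inj₁ (trans eq (off-u x x≢u))
      walked : Trail G M π′ s (suc j + ℓ)
      walked = subst (Trail G M π′ s) (+-suc j ℓ) (lead leads π′ (suc ℓ) others′ from-u)

  leads-end : ∀ {M π π₁ s u v j} → Leads G M π s u j → Moved π u v π₁ →
              Edge (graph G) u v → M v ≡ nothing → Trail G M π₁ s (suc j)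
  leads-end {M} {π} {π₁} {s} {u} {v} {j} leads (at-u , off-u) e m =
    subst (Trail G M π₁ s) (+-comm j 1) (lead leads π₁ 1 others from-u)
    where
    from-u : Trail G M π₁ u 1
    from-u = end at-u e m
    others : ∀ x → π₁ x ≡ π x ⊎ Trail G M π₁ x 1
    others x with x ≟ u
    ... | yes refl = inj₂ from-u
    ... | no x≢u   = inj₁ (off-u x x≢u)

  -- M consists of edges of G.
  Valid : (Fin n → Maybe (Fin n)) → Set
  Valid M = ∀ {q u} → M q ≡ just u → Edge (graph G) u q

-- M with q matched to u.
place : ∀ {n} → (Fin n → Maybe (Fin n)) → Fin n → Fin n → Fin n → Maybe (Fin n)
place M q u x = if toℕ q ≡ᵇ toℕ x then just u else M x

place-hit : ∀ {n} (M : Fin n → Maybe (Fin n)) q u → place M q u q ≡ just u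
place-hit M q u rewrite ≡ᵇ-refl (toℕ q) = refl

place-miss : ∀ {n} (M : Fin n → Maybe (Fin n)) q u {x} → x ≢ q → place M q u x ≡ M x
place-miss M q u x≢q rewrite ≢⇒≡ᵇ (x≢q ∘ sym ∘ toℕ-injective) = refl

holds-place : ∀ {n} {M : Fin n → Maybe (Fin n)} {q u σ} → Holds M σ →
  Holds (place M q u) (σ ⟨ mate q ≔ suc (toℕ u) ⟩)
holds-place {M = M} {q} {u} {σ} h = record { mates = updated ; one≡ = one≡ h ; width≡ = width≡ h }
  where
  updated : ∀ x → (σ ⟨ mate q ≔ suc (toℕ u) ⟩) (mate x) ≡ encode (place M q u x)
  updated x with toℕ q ≡ᵇ toℕ x
  ... | true  = refl
  ... | false = mates h x

sum-update : ∀ {k} (f g : Fin k → ℕ) i → (∀ j → j ≢ i → f j ≡ g j) → sum f + g i ≡ sum g + f i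
sum-update f g zero same = begin
  f zero + sum (f ∘ suc) + g zero
    ≡⟨ cong (λ s → f zero + s + g zero) (sum-cong-≗ (λ j → same (suc j) λ ())) ⟩
  f zero + sum (g ∘ suc) + g zero
    ≡⟨ solve 3 (λ a s b → a :+ s :+ b := b :+ s :+ a) refl (f zero) _ (g zero) ⟩
  g zero + sum (g ∘ suc) + f zero ∎
  where open ≡-Reasoning
        open +-*-Solver
sum-update f g (suc i) same = begin
  f zero + sum (f ∘ suc) + g (suc i)   ≡⟨ +-assoc (f zero) _ _ ⟩
  f zero + (sum (f ∘ suc) + g (suc i))
    ≡⟨ cong₂ _+_ (same zero λ ()) (sum-update (f ∘ suc) (g ∘ suc) i (λ j j≢i → same (suc j) (j≢i ∘ suc-injective))) ⟩
  g zero + (sum (g ∘ suc) + f (suc i)) ≡⟨ +-assoc (g zero) _ _ ⟨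
  g zero + sum (g ∘ suc) + f (suc i)   ∎
  where open ≡-Reasoning

unmatched-removeAt : ∀ {n k} {M : Fin n → Maybe (Fin n)} {X : Fin (suc k) → Fin n} →
                     Unmatched M X → ∀ i → Unmatched M (X i ∷ᶠ removeAt X i)
unmatched-removeAt {M = M} {X} unmatched i = balanced λ f →
  trans (cong (sum (λ q → maybe′ f 0 (M q)) +_) (sym (sum-remove {i = i} (f ∘ X)))) (balance unmatched f)

module _ {n k} {M : Fin n → Maybe (Fin n)} {u : Fin n} {Y : Fin k → Fin n}
         (unmatched : Unmatched M (u ∷ᶠ Y)) {q : Fin n} where

  private
    -- Placing u at q exchanges u for the former mate of q.
    exchange : ∀ f → sum (λ x → maybe′ f 0 (place M q u x)) + (maybe′ f 0 (M q) + sum (f ∘ Y)) ≡ sum f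
    exchange f = begin
      sum (λ x → maybe′ f 0 (place M q u x)) + (maybe′ f 0 (M q) + sum (f ∘ Y))
        ≡⟨ +-assoc (sum (λ x → maybe′ f 0 (place M q u x))) _ _ ⟨
      sum (λ x → maybe′ f 0 (place M q u x)) + maybe′ f 0 (M q) + sum (f ∘ Y)
        ≡⟨ cong (_+ sum (f ∘ Y)) (sum-update (λ x → maybe′ f 0 (place M q u x)) (λ x → maybe′ f 0 (M x)) q
             (λ x x≢q → cong (maybe′ f 0) (place-miss M q u x≢q))) ⟩
      sum (λ x → maybe′ f 0 (M x)) + maybe′ f 0 (place M q u q) + sum (f ∘ Y)
        ≡⟨ cong (λ w → sum (λ x → maybe′ f 0 (M x)) + maybe′ f 0 w + sum (f ∘ Y)) (place-hit M q u) ⟩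
      sum (λ x → maybe′ f 0 (M x)) + f u + sum (f ∘ Y)
        ≡⟨ +-assoc (sum (λ x → maybe′ f 0 (M x))) _ _ ⟩
      sum (λ x → maybe′ f 0 (M x)) + (f u + sum (f ∘ Y))
        ≡⟨ balance unmatched f ⟩
      sum f ∎
      where open ≡-Reasoning

  unmatched-place : M q ≡ nothing → Unmatched (place M q u) Y
  unmatched-place free = balanced λ f → trans
    (cong (λ w → sum (λ x → maybe′ f 0 (place M q u x)) + (maybe′ f 0 w + sum (f ∘ Y))) (sym free))
    (exchange f)

  unmatched-displace : ∀ {y} → M q ≡ just y → Unmatched (place M q u) (y ∷ᶠ Y)
  unmatched-displace taken = balanced λ f → trans
    (cong (λ w → sum (λ x → maybe′ f 0 (place M q u x)) + (maybe′ f 0 w + sum (f ∘ Y))) (sym taken))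
    (exchange f)

module _ {n} {G : Input n} where

  valid-place : ∀ {M q u} → Valid {G = G} M → Edge (graph G) u q → Valid {G = G} (place M q u)
  valid-place {M} {q} {u} valid e {x} m with x ≟ q
  ... | yes refl = subst (λ w → Edge (graph G) w q)
                     (just-injective (trans (sym (place-hit M q u)) m)) e
  ... | no x≢q   = valid (trans (sym (place-miss M q u x≢q)) m)

  -- Changing the mate of q does not affect a trail that avoids q, and one
  -- through q continues from the mate y of q.
  trail-avoids : ∀ {M π q u y x ℓ} → M q ≡ just y → Trail G M π x ℓ →
    Trail G (place M q u) π x ℓ ⊎ ∃[ ℓ′ ] (ℓ′ < ℓ × Trail G M π y ℓ′)
  trail-avoids {M} {q = q} {u} m (end {q = q′} eq e free) =
    inj₁ (end eq e (trans (place-miss M q u q′≢q) free))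
    where
    q′≢q : q′ ≢ q
    q′≢q refl with () ← trans (sym m) free
  trail-avoids {M} {π} {q} {u} m (next {q = q′} {y = y′} {ℓ} eq e m′ tail) with q′ ≟ q
  ... | yes refl = inj₂ (ℓ , n<1+n ℓ ,
          subst (λ w → Trail G M π w ℓ) (just-injective (trans (sym m′) m)) tail)
  ... | no q′≢q with trail-avoids {u = u} m tail
  ...   | inj₁ tail′          = inj₁ (next eq e (trans (place-miss M q u q′≢q) m′) tail′)
  ...   | inj₂ (ℓ′ , lt , t′) = inj₂ (ℓ′ , m<n⇒m<1+n lt , t′)

  -- A shortest trail from the mate of q does not return to q.
  trail-place : ∀ {M π q u y} → M q ≡ just y → ∀ {ℓ} → Trail G M π y ℓ → Trail G (place M q u) π y ℓ
  trail-place {M} {π} {q} {u} {y} m {ℓ} = go (<-wellFounded ℓ)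
    where
    go : ∀ {ℓ} → Acc _<_ ℓ → Trail G M π y ℓ → Trail G (place M q u) π y ℓ
    go (acc rec) t with trail-avoids {u = u} m t
    ... | inj₁ t′             = t′
    ... | inj₂ (ℓ′ , lt , t′) = Trail-mono (<⇒≤ lt) (go (rec lt) t′)

  open Algorithm n

  -- Augmenting along a trail of length ℓ matches u and leaves Y unmatched.
  augment-finds : ∀ {k C b} {Y : Fin k → Fin n} →
    (∀ {M σ} → Valid {G = G} M → Unmatched M Y → Holds M σ → Finds G C σ b) →
    ∀ {ℓ M σ u} → Valid {G = G} M → Unmatched M (u ∷ᶠ Y) → Holds M σ → σ (reg cur) ≡ toℕ u →
    Trail G M (σ ∘ pointer) u ℓ → Finds G (augment ℓ C) σ (b + 7 * ℓ)
  augment-finds {k} {C} {b} {Y} done {suc ℓ} {M} {σ} {u} valid unmatched h at-u trail =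
    Finds-mono (≤-reflexive (solve 2 (λ b ℓ → con 7 :+ (b :+ con 7 :* ℓ) := b :+ con 7 :* (con 1 :+ ℓ)) refl b ℓ))
      (main trail)
    where
    open +-*-Solver
    rebase : ∀ {M′ q x} → Holds M′ (σ ⟨ mate q ≔ suc (toℕ u) ⟩) → Holds M′
      (σ ⟨ reg nbr ≔ toℕ q ⟩ ⟨ reg slot ≔ n + toℕ q ⟩ ⟨ reg val ≔ encode (M q) ⟩
         ⟨ reg new ≔ suc (toℕ u) ⟩ ⟨ mate q ≔ suc (toℕ u) ⟩ ⟨ reg cur ≔ x ⟩)
    rebase h′ = record { mates = mates h′ ; one≡ = one≡ h′ ; width≡ = width≡ h′ }
    loaded : ∀ {E q c} → σ (pointer u) ≡ toℕ q →
      Finds G E (σ ⟨ reg nbr ≔ toℕ q ⟩ ⟨ reg slot ≔ n + toℕ q ⟩ ⟨ reg val ≔ encode (M q) ⟩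
                   ⟨ reg new ≔ suc (toℕ u) ⟩ ⟨ mate q ≔ suc (toℕ u) ⟩) c →
      Finds G (loadᵒ (ρ nbr) (ρ cur) ▸ addᵒ (ρ slot) (ρ width) (ρ nbr) ▸ loadᵒ (ρ val) (ρ slot) ▸
               addᵒ (ρ new) (ρ cur) (ρ one) ▸ storeᵒ (ρ slot) (ρ new) ▸ E) σ (5 + c)
    loaded {q = q} eq f = load-rule (pointer u) at-u eq (add-rule (cong (_+ toℕ q) (width≡ h))
      (load-rule (mate q) refl (mates h q)
      (add-rule (trans (cong₂ _+_ at-u (one≡ h)) (+-comm (toℕ u) 1)) (store-rule (mate q) refl refl f))))
    main : Trail G M (σ ∘ pointer) u (suc ℓ) → Finds G (augment (suc ℓ) C) σ (7 + (b + 7 * ℓ))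
    main (end {q = q} eq e free) = loaded eq (zero-rule (cong encode free)
      (Finds-mono (≤-trans (m≤m+n b (7 * ℓ)) (n≤1+n _))
        (done (valid-place valid e) (unmatched-place unmatched free)
          (holds-place (record { mates = mates h ; one≡ = one≡ h ; width≡ = width≡ h })))))
    main (next {q = q} {y} eq e taken tail) = loaded eq (suc-rule (cong encode taken)
      (sub-rule {x = toℕ y} (cong₂ _∸_ (cong encode taken) (one≡ h))
        (augment-finds done (valid-place valid e) (unmatched-displace unmatched taken)
          (rebase (holds-place {M = M} {q} {u} h)) refl (trail-place taken tail))))

-- Perfect matchings by counting

sum-≤-≡ : ∀ {k} {f g : Fin k → ℕ} → (∀ i → f i ≤ g i) → sum f ≡ sum g → ∀ i → f i ≡ g i
sum-≤-≡ {suc k} {f} {g} f≤g eq = λ where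
    zero    → ≤-antisym (f≤g zero) (+-cancelʳ-≤ (sum (g ∘ suc)) _ _
                (≤-trans (≤-reflexive (sym eq)) (+-monoʳ-≤ (f zero) (sum-mono-≤ (f≤g ∘ suc)))))
    (suc i) → sum-≤-≡ (f≤g ∘ suc) (≤-antisym (sum-mono-≤ (f≤g ∘ suc))
                (+-cancelˡ-≤ (g zero) _ _ (≤-trans (≤-reflexive (sym eq)) (+-monoˡ-≤ _ (f≤g zero))))) i

two-terms : ∀ {k} (f : Fin k → ℕ) {i j} → i ≢ j → f i + f j ≤ sum f
two-terms f {zero}  {zero}  i≢j = contradiction refl i≢j
two-terms f {zero}  {suc j} i≢j = +-monoʳ-≤ (f zero) (term≤sum (f ∘ suc) j)
two-terms f {suc i} {zero}  i≢j =
  ≤-trans (≤-reflexive (+-comm (f (suc i)) _)) (+-monoʳ-≤ (f zero) (term≤sum (f ∘ suc) i))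
two-terms f {suc i} {suc j} i≢j = ≤-trans (two-terms (f ∘ suc) (i≢j ∘ cong suc)) (m≤n+m _ (f zero))

positive-term : ∀ {k} (f : Fin k → ℕ) → 1 ≤ sum f → ∃ λ i → 1 ≤ f i
positive-term {suc k} f le with f zero in eq
... | suc _ = zero , ≤-trans (s≤s z≤n) (≤-reflexive (sym eq))
... | zero with positive-term (f ∘ suc) le
...   | i , p = suc i , p

-- Dividing each term by k, rounding down, divides the average by k.
average-/ : ∀ {T k z} .{{_ : NonZero T}} .{{_ : NonZero k}} (f : Fin T → ℕ) →
            sum f ≤ T * z → sum (λ t → f t / k) / T ≤ z / k
average-/ {T} {k} {z} f le = begin
  y / T              ≡⟨ m*n/n≡m (y / T) k ⟨
  y / T * k / k      ≤⟨ /-monoˡ-≤ k (*-cancelˡ-≤ T (begin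
    T * (y / T * k)      ≡⟨ solve 3 (λ T a k → T :* (a :* k) := k :* (a :* T)) refl T (y / T) k ⟩
    k * (y / T * T)      ≤⟨ *-monoʳ-≤ k (m/n*n≤m y T) ⟩
    k * y                ≡⟨ *-distribˡ-sum k (λ t → f t / k) ⟩
    sum (λ t → k * (f t / k)) ≤⟨ sum-mono-≤ (λ t → ≤-trans (≤-reflexive (*-comm k _)) (m/n*n≤m (f t) k)) ⟩
    sum f                ≤⟨ le ⟩
    T * z                ∎)) ⟩
  z / k              ∎
  where
  open ≤-Reasoning
  open +-*-Solver
  y = sum (λ t → f t / k)

-- The indicator function of p.
δ : ∀ {n} → Fin n → Fin n → ℕ
δ p x = indicator (toℕ p ≡ᵇ toℕ x)

sum-δ : ∀ {n} (p : Fin n) → sum (δ p) ≡ 1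
sum-δ {suc n} zero    = cong suc (trans (sum-const n 0) (*-zeroʳ n))
sum-δ {suc n} (suc p) = sum-δ p

δ-refl : ∀ {n} (p : Fin n) → δ p p ≡ 1
δ-refl p = cong indicator (≡ᵇ-refl (toℕ p))

δ⁻¹ : ∀ {n} (p x : Fin n) → 1 ≤ δ p x → p ≡ x
δ⁻¹ p x le with toℕ p ≡ᵇ toℕ x in eq
... | true  = toℕ-injective (≡ᵇ⇒≡ _ _ (subst T (sym eq) _))
... | false with () ← le

-- If no vertex of P is unmatched, then M is a bijection: sum the constant
-- function 1 and the indicator functions.
module Perfect {n} {M : Fin n → Maybe (Fin n)} {X : Fin 0 → Fin n} (unmatched : Unmatched M X) where

  private
    totals : ∀ f → sum (λ q → maybe′ f 0 (M q)) ≡ sum f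
    totals f = trans (sym (+-identityʳ _)) (balance unmatched f)

    at-most-1 : ∀ q → maybe′ (λ (_ : Fin n) → 1) 0 (M q) ≤ 1
    at-most-1 q with M q
    ... | just _  = ≤-refl
    ... | nothing = z≤n

  mate-exists : ∀ q → ∃ λ p → M q ≡ just p
  mate-exists q with M q | sum-≤-≡ at-most-1 (totals (λ _ → 1)) q
  ... | just p | _ = p , refl

  mate-of : ∀ p → ∃ λ q → M q ≡ just p
  mate-of p with positive-term (λ q → maybe′ (δ p) 0 (M q))
                   (≤-reflexive (sym (trans (totals (δ p)) (sum-δ p))))
  ... | q , le = q , found (M q) refl
    where
    found : ∀ w → M q ≡ w → M q ≡ just p
    found nothing  eq with () ← subst (λ w → 1 ≤ maybe′ (δ p) 0 w) eq le
    found (just x) eq = trans eq (cong just (sym (δ⁻¹ p x (subst (λ w → 1 ≤ maybe′ (δ p) 0 w) eq le))))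

  mate-unique : ∀ {p q q′} → M q ≡ just p → M q′ ≡ just p → q ≡ q′
  mate-unique {p} {q} {q′} m m′ with q ≟ q′
  ... | yes eq = eq
  ... | no q≢q′ = contradiction (begin
    2                                               ≡⟨ cong₂ _+_ (term m) (term m′) ⟨
    maybe′ (δ p) 0 (M q) + maybe′ (δ p) 0 (M q′)    ≤⟨ two-terms (λ q → maybe′ (δ p) 0 (M q)) q≢q′ ⟩
    sum (λ q → maybe′ (δ p) 0 (M q))                ≡⟨ trans (totals (δ p)) (sum-δ p) ⟩
    1                                               ∎) λ { (s≤s ()) }
    where
    open ≤-Reasoning
    term : ∀ {q} → M q ≡ just p → maybe′ (δ p) 0 (M q) ≡ 1
    term m = trans (cong (maybe′ (δ p) 0) m) (δ-refl p)

module _ {n} {G : Input n} where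

  open Algorithm n

  -- The pointer of the mate of q is q.
  Written : (Fin n → Maybe (Fin n)) → Store n → Fin n → Set
  Written M σ q = ∀ {p} → M q ≡ just p → σ (pointer p) ≡ toℕ q

  writeOut-finds : ∀ {M σ} {X : Fin 0 → Fin n} → Valid {G = G} M → Unmatched M X → Holds M σ →
    ∀ qs → (∀ q → q ∈ qs ⊎ Written M σ q) → Finds G (writeOut qs) σ (length qs * 5)
  writeOut-finds {M} {σ} {X} valid unmatched h [] written = finds λ m m∼σ →
    let written′ : ∀ {p q} → M q ≡ just p → m (toℕ p) ≡ toℕ q
        written′ {p} {q} mq = case-written m (written q) mq m∼σ
        partner : ∀ {p q} → m (toℕ p) ≡ toℕ q → M q ≡ just p
        partner {p} {q} eq = let q′ , mq′ = mate-of p in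
          subst (λ q → M q ≡ just p) (toℕ-injective (trans (sym (written′ mq′)) eq)) mq′
    in (λ p q eq → valid (partner eq))
     , (λ p → let q , mq = mate-of p in
          q , written′ mq , λ eq → toℕ-injective (trans (sym (written′ mq)) eq))
     , (λ q → let p , mq = mate-exists q in
          p , written′ mq , λ eq → just-injective (trans (sym mq) (partner eq)))
    where
    open Perfect unmatched
    case-written : ∀ m {p q} → q ∈ [] ⊎ Written M σ q → M q ≡ just p → m ∼ σ → m (toℕ p) ≡ toℕ q
    case-written m {p} (inj₂ w) mq m∼σ = trans (m∼σ (pointer p)) (w mq)
  writeOut-finds {M} {σ} valid unmatched h (q ∷ qs) written with Perfect.mate-exists unmatched q
  ... | p , mq = const-rule (const-rule (load-rule (mate q) refl (trans (mates h q) (cong encode mq))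
        (sub-rule {x = toℕ p} (cong (suc (toℕ p) ∸_) (one≡ h)) (store-rule (pointer p) refl refl
          (writeOut-finds valid unmatched
            (record { mates = mates h ; one≡ = one≡ h ; width≡ = width≡ h }) qs written′)))))
    where
    σ′ : Store n
    σ′ = σ ⟨ reg nbr ≔ toℕ q ⟩ ⟨ reg slot ≔ addr (mate q) ⟩ ⟨ reg val ≔ suc (toℕ p) ⟩
           ⟨ reg cur ≔ toℕ p ⟩ ⟨ pointer p ≔ toℕ q ⟩
    now : Written M σ′ q
    now {p′} mq′ with just-injective (trans (sym mq) mq′)
    ... | refl rewrite ≡ᵇ-refl (toℕ p) = refl
    still : ∀ {x} → Written M σ x → Written M σ′ x
    still {x} w {p′} mx with p′ ≟ p
    ... | yes refl = trans (now mq) (cong toℕ (Perfect.mate-unique unmatched mq mx))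
    ... | no p′≢p rewrite ≢⇒≡ᵇ (p′≢p ∘ sym ∘ toℕ-injective) = w mx
    written′ : ∀ x → x ∈ qs ⊎ Written M σ′ x
    written′ x with written x
    ... | inj₁ (here refl) = inj₂ now
    ... | inj₁ (there x∈)  = inj₁ x∈
    ... | inj₂ w           = inj₂ (still w)

-- A bound on the expected time for matching k remaining vertices. To match one
-- of them takes 2 steps to set the current vertex, before the walk and before
-- the augmentation, 2 units for rounding the averages over t and i, and the
-- average potential, with 15 units per step and 1 for the abandoned walks.
matchTime : (n k : ℕ) → ℕ
matchTime n zero    = n * 5
matchTime n (suc k) = 4 + matchTime n k + n * 16 / suc k

module _ {n} {G : Input n} where

  open Algorithm n

  private
    instance
      d≢0 = degree-nonZero G

  -- The walk from s, where the continuation S needs an expected time of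
  -- β + 7 j after a walk of length j.
  module _ {M : Fin n → Maybe (Fin n)} {s : Fin n} {S : ℕ → Code} {β : ℕ}
           (done : ∀ j {σ} → Holds M σ → Trail G M (σ ∘ pointer) s j → Finds G (S j) σ (β + 7 * j))
           where

    open Walk G M

    -- The 15 units per step are 7 for the walk, 7 for the augmentation, and 1
    -- for rounding.
    randomWalk-finds : ∀ {F B} → (∀ {σ} → Holds M σ → Finds G F σ (B + β)) →
      ∀ t {j σ u} → Holds M σ → σ (reg cur) ≡ toℕ u → Leads G M (σ ∘ pointer) s u j →
      Finds G (randomWalk (d G) t j S F) σ ((β + 7 * j) + potential 15 B t u)
    randomWalk-finds {F} {B} abandon zero {j} h at-u leads =
      Finds-mono (≤-trans (≤-reflexive (+-comm B β)) (+-monoˡ-≤ B (m≤m+n β (7 * j)))) (abandon h)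
    randomWalk-finds {F} {B} abandon (suc t) {j} {σ} {u} h at-u leads =
      Finds-mono (≤-reflexive (regroup _)) (rand-rule
        (λ r → maybe′ (potential 15 B t) 0 (M (array G P u r))) λ r →
        walkStep-finds u r h at-u
          (λ free h′ moved → Finds-mono (m≤m+n (β + 7 * suc j) _)
            (done (suc j) h′ (leads-end leads moved (array-edge G u r) free)))
          (λ y taken h′ moved at-y → Finds-mono
            (≤-reflexive (cong (λ w → β + 7 * suc j + maybe′ (potential 15 B t) 0 w) (sym taken)))
            (randomWalk-finds abandon t h′ at-y (leads-step leads moved (array-edge G u r) taken))))
      where
      regroup : ∀ x → 7 + (β + 7 * suc j) + suc x ≡ (β + 7 * j) + (15 + x)
      regroup = solve 3 (λ β j x → con 7 :+ (β :+ con 7 :* (con 1 :+ j)) :+ (con 1 :+ x)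
                              := (β :+ con 7 :* j) :+ (con 15 :+ x)) refl β j
        where open +-*-Solver

    -- The continuation F is needed only if the walk does not escape.
    fixedWalk-finds : ∀ {F b} {t} (rs : Vec (Fin (d G)) t) {u} →
      (escapes rs u ≢ true → ∀ {σ} → Holds M σ → Finds G F σ b) →
      ∀ {j σ} → β + 7 * (j + t) ≤ b → Holds M σ → σ (reg cur) ≡ toℕ u →
      Leads G M (σ ∘ pointer) s u j → Finds G (fixedWalk (d G) rs j S F) σ (7 * t + b)
    fixedWalk-finds [] abandon le h at-u leads = abandon (λ ()) h
    fixedWalk-finds {F} {b} {suc t} (r ∷ rs) {u} abandon {j} le h at-u leads =
      Finds-mono (≤-reflexive (solve 2 (λ t b → con 7 :+ (con 7 :* t :+ b)
                                     := con 7 :* (con 1 :+ t) :+ b) refl t b))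
      (walkStep-finds u r h at-u
        (λ free h′ moved → Finds-mono
          (≤-trans (≤-trans (+-monoʳ-≤ β (*-monoʳ-≤ 7 (m≤m+n (suc j) t))) le′) (m≤n+m b (7 * t)))
          (done (suc j) h′ (leads-end leads moved (array-edge G u r) free)))
        (λ y taken h′ moved at-y → fixedWalk-finds rs
          (λ trapped → abandon (trapped ∘ trans (sym (cong (maybe′ (escapes rs) true) taken))))
          le′ h′ at-y (leads-step leads moved (array-edge G u r) taken)))
      where
      open +-*-Solver
      le′ : β + 7 * (suc j + t) ≤ b
      le′ = subst (λ i → β + 7 * i ≤ b) (+-suc j t) le

    tryWalks-finds : ∀ {t} {rss : List (Vec (Fin (d G)) t)} → Any (λ rs → escapes rs s ≡ true) rss →
      ∀ {σ} → Holds M σ →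
      Finds G (tryWalks (d G) rss s S) σ (length rss * (1 + 7 * t) + (β + 7 * t))
    tryWalks-finds {t} {rs ∷ rss} some {σ} h =
      Finds-mono (≤-reflexive (cong suc (sym (+-assoc (7 * t) (length rss * (1 + 7 * t)) _))))
      (const-rule (fixedWalk-finds rs (others some) (m≤n+m _ (length rss * (1 + 7 * t)))
        (record { mates = mates h ; one≡ = one≡ h ; width≡ = width≡ h }) refl leads-start))
      where
      others : Any (λ rs → escapes rs s ≡ true) (rs ∷ rss) → escapes rs s ≢ true →
        ∀ {σ} → Holds M σ → Finds G (tryWalks (d G) rss s S) σ (length rss * (1 + 7 * t) + (β + 7 * t))
      others (here esc)   trapped = contradiction esc trapped
      others (there some) _ h     = tryWalks-finds some h

  match-finds : ∀ k {X : Fin k → Fin n} {M σ} → Valid {G = G} M → Unmatched M X → Holds M σ →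
                Finds G (match (d G) k X) σ (matchTime n k)
  match-finds zero {X} valid unmatched h = subst (λ l → Finds G (writeOut (allFin n)) _ (l * 5)) (length-tabulate {n = n} id)
    (writeOut-finds valid unmatched h (allFin n) (λ q → inj₁ (∈-allFin q)))
  match-finds (suc k) {X} {M} {σ} valid unmatched h =
    Finds-mono bound (rand-rule (λ t → Φ (toℕ t) / suc k) λ t →
      Finds-mono (≤-reflexive (+-suc (2 + matchTime n k) _))
      (rand-rule (λ i → potential 15 B (toℕ t) (X i)) λ i →
        Finds-mono (≤-reflexive (cong (λ w → 2 + w + potential 15 B (toℕ t) (X i)) (+-identityʳ (matchTime n k))))
        (const-rule (randomWalk-finds (along i) (abandon i) (toℕ t)
          (record { mates = mates h ; one≡ = one≡ h ; width≡ = width≡ h }) refl leads-start))))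
    where
    open Walk G M
    L = suc n
    B = tryCost (d G)
    β = suc (matchTime n k)
    Φ : ℕ → ℕ
    Φ t = sum (potential 15 B t ∘ X)
    alongCode : Fin (suc k) → ℕ → Code
    alongCode i j = augmentFrom (X i) j (match (d G) k (removeAt X i))
    along : ∀ i j {σ} → Holds M σ → Trail G M (σ ∘ pointer) (X i) j → Finds G (alongCode i j) σ (β + 7 * j)
    along i j h trail = const-rule (augment-finds (match-finds k) valid
      (unmatched-removeAt unmatched i)
      (record { mates = mates h ; one≡ = one≡ h ; width≡ = width≡ h }) refl trail)
    abandon : ∀ i {σ} → Holds M σ → Finds G (tryWalks (d G) (allVecs (d G) L) (X i) (alongCode i)) σ (B + β)
    abandon i h = Finds-mono (≤-reflexive (solve 3 (λ a b c → a :+ (b :+ c) := (a :+ c) :+ b) refl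
        (length (allVecs (d G) L) * (1 + 7 * L)) β (7 * L)))
      (tryWalks-finds (along i) (some-walk-escapes G unmatched i) h)
      where open +-*-Solver
    average : sum {suc B} (λ t → Φ (toℕ t) / suc k) / suc B ≤ n * 16 / suc k
    average = average-/ (Φ ∘ toℕ) (potential-average unmatched 15 B (suc B) (n≤1+n B))
    bound : (3 + matchTime n k) + suc (sum {suc B} (λ t → Φ (toℕ t) / suc k) / suc B) ≤ matchTime n (suc k)
    bound = ≤-trans (≤-reflexive (+-suc (3 + matchTime n k) _)) (+-monoʳ-≤ (4 + matchTime n k) average)

no-matches : ∀ {n} → Unmatched {n} {n} (λ _ → nothing) id
no-matches {n} = balanced λ f → cong (_+ sum f) (trans (sum-const n 0) (*-zeroʳ n))

module _ {n} {G : Input n} where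

  open Algorithm n

  start-finds : ∀ c {σ} → suc c ≡ d G → Holds (λ _ → nothing) σ →
                Finds G (match (suc c) n id) σ (matchTime n n)
  start-finds c eq h = at (suc c) eq
    where
    at : ∀ D .{{_ : NonZero D}} → D ≡ d G → Finds G (match D n id) _ (matchTime n n)
    at D refl = match-finds n (λ ()) no-matches h

  dispatch-finds : ∀ f c {σ} → Holds (λ _ → nothing) σ → σ (reg val) ≡ d G ∸ c → c < d G →
                   d G ≤ c + f → Finds G (dispatch f c) σ (f * 2 + matchTime n n)
  dispatch-finds zero    c h eq c<d d≤ =
    contradiction (≤-trans c<d (≤-trans d≤ (≤-reflexive (+-identityʳ c)))) 1+n≰n
  dispatch-finds (suc f) c {σ} h eq c<d d≤ = sub-rule {x = d G ∸ suc c} (begin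
      σ (reg val) ∸ σ (reg one)    ≡⟨ cong₂ _∸_ eq (one≡ h) ⟩
      d G ∸ c ∸ 1                  ≡⟨ ∸-+-assoc (d G) c 1 ⟩
      d G ∸ (c + 1)                ≡⟨ cong (d G ∸_) (+-comm c 1) ⟩
      d G ∸ suc c                  ∎) (test (d G ∸ suc c) refl)
    where
    open ≡-Reasoning
    h′ : ∀ {x} → Holds (λ _ → nothing) (σ ⟨ reg val ≔ x ⟩)
    h′ = record { mates = mates h ; one≡ = one≡ h ; width≡ = width≡ h }
    test : ∀ x → d G ∸ suc c ≡ x → Finds G (ifZero (ρ val) (match (suc c) n id) (dispatch f (suc c)))
             (σ ⟨ reg val ≔ d G ∸ suc c ⟩) (suc (f * 2 + matchTime n n))
    test zero    x≡ = zero-rule x≡ (Finds-mono (m≤n+m _ (f * 2))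
      (start-finds c (≤-antisym c<d (m∸n≡0⇒m≤n x≡)) h′))
    test (suc x) x≡ = suc-rule x≡ (dispatch-finds f (suc c) h′ refl
      (m∸n≢0⇒n<m (λ z → contradiction (trans (sym z) x≡) λ ()))
      (≤-trans d≤ (≤-reflexive (+-suc c f))))

  d≤n : Fin n → d G ≤ n
  d≤n u = subst (_≤ n) (proj₂ (regular G) P u) (∣p∣≤n (Vec.tabulate (adjacent (graph G) P u)))

-- A bound on the expected time of the algorithm: 3 steps of initialization and
-- at most 2 n steps to find the degree come before the matching.
algorithmTime : ℕ → ℕ
algorithmTime n = 3 + (n * 2 + matchTime n n)

algorithm-finds : ∀ {n} (G : Input n) → Finds G (Algorithm.algorithm n) (λ _ → 0) (algorithmTime n)
algorithm-finds {zero}  G = const-rule (const-rule (getDegree-rule (finds λ m _ → (λ ()) , (λ ()) , λ ())))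
algorithm-finds {suc n} G = const-rule (const-rule (getDegree-rule (dispatch-finds (suc n) 0
  (record { mates = λ q → refl ; one≡ = refl ; width≡ = refl }) refl
  (proj₁ (regular G)) (d≤n {G = G} zero))))

-- Harmonic sums

-- The sum of X / j for 1 ≤ j ≤ k, with each term rounded down.
harmonic : ℕ → ℕ → ℕ
harmonic X zero    = 0
harmonic X (suc k) = harmonic X k + X / suc k

harmonic-mono : ∀ X {k l} → k ≤ l → harmonic X k ≤ harmonic X l
harmonic-mono X {l = l} z≤n = z≤n
harmonic-mono X {suc k} {suc l} (s≤s k≤l) with k ≟ₙ l
... | yes refl = ≤-refl
... | no k≢l   = ≤-trans (harmonic-mono X (≤∧≢⇒< k≤l k≢l)) (m≤m+n _ _)

-- The terms for 2 j and 2 j + 1 are together at most the term for j.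
harmonic-double : ∀ X m → harmonic X (suc (m * 2)) ≤ X + harmonic X m
harmonic-double X zero    = ≤-trans (m/n≤m X 1) (m≤m+n X 0)
harmonic-double X (suc m) = begin
  h + X / suc (suc (m * 2)) + X / suc (suc (suc (m * 2)))
    ≤⟨ +-monoʳ-≤ (h + X / suc (suc (m * 2))) (/-monoʳ-≤ X (n≤1+n (suc (suc (m * 2))))) ⟩
  h + X / suc (suc (m * 2)) + X / suc (suc (m * 2))
    ≡⟨ solve 2 (λ h a → h :+ a :+ a := h :+ a :* con 2) refl h _ ⟩
  h + X / suc (suc (m * 2)) * 2
    ≤⟨ +-mono-≤ (harmonic-double X m) halve ⟩
  X + harmonic X m + X / suc m    ≡⟨ +-assoc X _ _ ⟩
  X + (harmonic X m + X / suc m)  ∎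
  where
  open ≤-Reasoning
  open +-*-Solver
  h = harmonic X (suc (m * 2))
  halve : X / suc (suc (m * 2)) * 2 ≤ X / suc m
  halve = begin
    X / suc (suc (m * 2)) * 2                   ≡⟨ m*n/n≡m (X / suc (suc (m * 2)) * 2) (suc m) ⟨
    X / suc (suc (m * 2)) * 2 * suc m / suc m   ≤⟨ /-monoˡ-≤ (suc m) (begin
      X / suc (suc (m * 2)) * 2 * suc m
        ≡⟨ solve 2 (λ a m → a :* con 2 :* (con 1 :+ m) := a :* (con 2 :+ m :* con 2)) refl (X / suc (suc (m * 2))) m ⟩
      X / suc (suc (m * 2)) * suc (suc (m * 2)) ≤⟨ m/n*n≤m X (suc (suc (m * 2))) ⟩
      X                                         ∎) ⟩
    X / suc m                                   ∎

n≤1+⌊n/2⌋*2 : ∀ n → n ≤ suc (⌊ n /2⌋ * 2)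
n≤1+⌊n/2⌋*2 zero          = z≤n
n≤1+⌊n/2⌋*2 (suc zero)    = s≤s z≤n
n≤1+⌊n/2⌋*2 (suc (suc n)) = s≤s (s≤s (n≤1+⌊n/2⌋*2 n))

1≤⌊log₂n⌋ : ∀ {n} → 2 ≤ n → 1 ≤ ⌊log₂ n ⌋
1≤⌊log₂n⌋ {n} le = subst (_≤ ⌊log₂ n ⌋) (⌊log₂[2^n]⌋≡n 1) (⌊log₂⌋-mono-≤ le)

harmonic-log : ∀ X k → harmonic X k ≤ X * suc ⌊log₂ k ⌋
harmonic-log X k = go k (<-wellFounded k)
  where
  open ≤-Reasoning
  go : ∀ k → Acc _<_ k → harmonic X k ≤ X * suc ⌊log₂ k ⌋
  go zero          _         = z≤n
  go (suc zero)    _         = ≤-trans (m/n≤m X 1) (m≤m*n X (suc ⌊log₂ 1 ⌋))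
  go k@(suc (suc k′)) (acc rec) = begin
    harmonic X k                       ≤⟨ harmonic-mono X (n≤1+⌊n/2⌋*2 k) ⟩
    harmonic X (suc (⌊ k /2⌋ * 2))     ≤⟨ harmonic-double X ⌊ k /2⌋ ⟩
    X + harmonic X ⌊ k /2⌋             ≤⟨ +-monoʳ-≤ X (go ⌊ k /2⌋ (rec (⌊n/2⌋<n (suc k′)))) ⟩
    X + X * suc ⌊log₂ ⌊ k /2⌋ ⌋        ≡⟨ *-suc X _ ⟨
    X * suc (suc ⌊log₂ ⌊ k /2⌋ ⌋)      ≡⟨ cong (λ l → X * suc (suc l)) (⌊log₂⌊n/2⌋⌋≡⌊log₂n⌋∸1 k) ⟩
    X * suc (suc (⌊log₂ k ⌋ ∸ 1))      ≡⟨ cong (λ l → X * suc l) (m+[n∸m]≡n (1≤⌊log₂n⌋ (s≤s (s≤s (z≤n {k′}))))) ⟩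
    X * suc ⌊log₂ k ⌋                  ∎

matchTime-harmonic : ∀ n k → matchTime n k ≡ n * 5 + k * 4 + harmonic (n * 16) k
matchTime-harmonic n zero    = sym (trans (+-identityʳ _) (+-identityʳ _))
matchTime-harmonic n (suc k) = trans (cong (λ t → 4 + t + n * 16 / suc k) (matchTime-harmonic n k))
  (solve 4 (λ n k h x → con 4 :+ (n :* con 5 :+ k :* con 4 :+ h) :+ x
                     := n :* con 5 :+ (con 1 :+ k) :* con 4 :+ (h :+ x)) refl n k _ (n * 16 / suc k))
  where open +-*-Solver

algorithmTime-log : ∀ {n} → 2 ≤ n → algorithmTime n ≤ 45 * (n * ⌊log₂ n ⌋)
algorithmTime-log {n} 2≤n = begin
  3 + (n * 2 + matchTime n n)
    ≡⟨ cong (λ t → 3 + (n * 2 + t)) (matchTime-harmonic n n) ⟩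
  3 + (n * 2 + (n * 5 + n * 4 + harmonic (n * 16) n))
    ≤⟨ +-mono-≤ (≤-trans (n≤1+n 3) (*-monoˡ-≤ 2 2≤n))
         (+-monoʳ-≤ (n * 2) (+-monoʳ-≤ (n * 5 + n * 4) (harmonic-log (n * 16) n))) ⟩
  n * 2 + (n * 2 + (n * 5 + n * 4 + n * 16 * suc l))
    ≡⟨ solve 2 (λ n l → n :* con 2 :+ (n :* con 2 :+ (n :* con 5 :+ n :* con 4 :+ n :* con 16 :* (con 1 :+ l)))
                     := n :* con 29 :* con 1 :+ n :* con 16 :* l) refl n l ⟩
  n * 29 * 1 + n * 16 * l
    ≤⟨ +-monoˡ-≤ (n * 16 * l) (*-monoʳ-≤ (n * 29) (1≤⌊log₂n⌋ 2≤n)) ⟩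
  n * 29 * l + n * 16 * l
    ≡⟨ solve 2 (λ n l → n :* con 29 :* l :+ n :* con 16 :* l := con 45 :* (n :* l)) refl n l ⟩
  45 * (n * l) ∎
  where
  open ≤-Reasoning
  open +-*-Solver
  l = ⌊log₂ n ⌋

-- Weights

abstract

  -- The embedding of ℕ in ℚ, kept abstract since unfolding it computes
  -- greatest common divisors.
  ι : ℕ → ℚ
  ι n = ℤ.+ n ℚ./ 1

  toℚᵘ-ι : ∀ n → toℚᵘ (ι n) ℚᵘ.≃ mkℚᵘ (ℤ.+ n) 0
  toℚᵘ-ι n = ℚₚ.toℚᵘ-fromℚᵘ (mkℚᵘ (ℤ.+ n) 0)

  ι-+ : ∀ m n → ι (m + n) ≡ ι m +ℚ ι n
  ι-+ m n = ℚₚ.toℚᵘ-injective (begin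
    toℚᵘ (ι (m + n))               ≈⟨ toℚᵘ-ι (m + n) ⟩
    mkℚᵘ (ℤ.+ (m + n)) 0             ≈⟨ *≡* (cong (ℤ._* ℤ.+ 1) (sym (cong₂ ℤ._+_ (ℤₚ.*-identityʳ (ℤ.+ m)) (ℤₚ.*-identityʳ (ℤ.+ n))))) ⟩
    mkℚᵘ (ℤ.+ m) 0 ℚᵘ.+ mkℚᵘ (ℤ.+ n) 0 ≈⟨ ℚᵘₚ.+-cong (toℚᵘ-ι m) (toℚᵘ-ι n) ⟨
    toℚᵘ (ι m) ℚᵘ.+ toℚᵘ (ι n)     ≈⟨ ℚₚ.toℚᵘ-homo-+ (ι m) (ι n) ⟨
    toℚᵘ (ι m +ℚ ι n)              ∎)
    where open import Relation.Binary.Reasoning.Setoid ℚᵘₚ.≃-setoid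

  ι-* : ∀ m n → ι (m * n) ≡ ι m *ℚ ι n
  ι-* m n = ℚₚ.toℚᵘ-injective (begin
    toℚᵘ (ι (m * n))               ≈⟨ toℚᵘ-ι (m * n) ⟩
    mkℚᵘ (ℤ.+ (m * n)) 0             ≈⟨ *≡* (cong (ℤ._* ℤ.+ 1) (ℤₚ.pos-* m n)) ⟩
    mkℚᵘ (ℤ.+ m) 0 ℚᵘ.* mkℚᵘ (ℤ.+ n) 0 ≈⟨ ℚᵘₚ.*-cong (toℚᵘ-ι m) (toℚᵘ-ι n) ⟨
    toℚᵘ (ι m) ℚᵘ.* toℚᵘ (ι n)     ≈⟨ ℚₚ.toℚᵘ-homo-* (ι m) (ι n) ⟨
    toℚᵘ (ι m *ℚ ι n)              ∎)
    where open import Relation.Binary.Reasoning.Setoid ℚᵘₚ.≃-setoid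

  ι-mono : ∀ {m n} → m ≤ n → ι m ≤ℚ ι n
  ι-mono {m} {n} m≤n = ℚₚ.toℚᵘ-cancel-≤ (begin
    toℚᵘ (ι m)    ≃⟨ toℚᵘ-ι m ⟩
    mkℚᵘ (ℤ.+ m) 0  ≤⟨ *≤* (ℤₚ.*-monoʳ-≤-nonNeg (ℤ.+ 1) (ℤ.+≤+ m≤n)) ⟩
    mkℚᵘ (ℤ.+ n) 0  ≃⟨ toℚᵘ-ι n ⟨
    toℚᵘ (ι n)    ∎)
    where open ℚᵘₚ.≤-Reasoning

  ι-cancel : ∀ {m n} → ι m ≤ℚ ι n → m ≤ n
  ι-cancel {m} {n} le = ℤₚ.drop‿+≤+ (ℤₚ.*-cancelʳ-≤-pos (ℤ.+ m) (ℤ.+ n) (ℤ.+ 1) (ℚᵘₚ.drop-*≤* (begin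
    mkℚᵘ (ℤ.+ m) 0  ≃⟨ toℚᵘ-ι m ⟨
    toℚᵘ (ι m)    ≤⟨ ℚₚ.toℚᵘ-mono-≤ le ⟩
    toℚᵘ (ι n)    ≃⟨ toℚᵘ-ι n ⟩
    mkℚᵘ (ℤ.+ n) 0  ∎)))
    where open ℚᵘₚ.≤-Reasoning

  ι-nonNegative : ∀ n → ℚ.NonNegative (ι n)
  ι-nonNegative n = ℚₚ.normalize-nonNeg n 1

  ι-positive : ∀ n .{{_ : NonZero n}} → ℚ.Positive (ι n)
  ι-positive n = ℚₚ.normalize-pos n 1

  ι-/1 : ∀ n → ι n ≡ ℤ.+ n ℚ./ 1
  ι-/1 n = refl

  ι-0 : ι 0 ≡ 0ℚ
  ι-0 = refl

  ι-1 : ι 1 ≡ 1ℚ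
  ι-1 = refl

  ι-3 : ι 3 ≡ 1ℚ +ℚ 1ℚ +ℚ 1ℚ
  ι-3 = refl

ι-sum : ∀ {s} (f : Fin s → ℕ) → ι (sum f) ≡ sumℚ (ι ∘ f)
ι-sum {zero}  f = ι-0
ι-sum {suc s} f = trans (ι-+ (f zero) _) (cong (ι (f zero) +ℚ_) (ι-sum (f ∘ suc)))

sumℚ-mono : ∀ {s} {f g : Fin s → ℚ} → (∀ i → f i ≤ℚ g i) → sumℚ f ≤ℚ sumℚ g
sumℚ-mono {zero}  f≤g = ℚₚ.≤-refl
sumℚ-mono {suc s} f≤g = ℚₚ.+-mono-≤ (f≤g zero) (sumℚ-mono (f≤g ∘ suc))

sumℚ-const : ∀ s x → sumℚ {s} (λ _ → x) ≡ ι s *ℚ x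
sumℚ-const zero    x = sym (trans (cong (_*ℚ x) ι-0) (ℚₚ.*-zeroˡ x))
sumℚ-const (suc s) x = begin
  x +ℚ sumℚ {s} (λ _ → x)    ≡⟨ cong₂ _+ℚ_ (sym (trans (cong (_*ℚ x) ι-1) (ℚₚ.*-identityˡ x))) (sumℚ-const s x) ⟩
  ι 1 *ℚ x +ℚ ι s *ℚ x       ≡⟨ ℚₚ.*-distribʳ-+ x (ι 1) (ι s) ⟨
  (ι 1 +ℚ ι s) *ℚ x          ≡⟨ cong (_*ℚ x) (ι-+ 1 s) ⟨
  ι (suc s) *ℚ x             ∎
  where open ≡-Reasoning

clear-denominator : ∀ q → 0ℚ ≤ℚ q → ∃[ a ] q *ℚ ι (↧ₙ q) ≡ ι a
clear-denominator q@(mkℚ (ℤ.+ a) b-1 c) _ = a , ℚₚ.toℚᵘ-injective (begin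
  toℚᵘ (q *ℚ ι (suc b-1))              ≈⟨ ℚₚ.toℚᵘ-homo-* q (ι (suc b-1)) ⟩
  toℚᵘ q ℚᵘ.* toℚᵘ (ι (suc b-1))       ≈⟨ ℚᵘₚ.*-congˡ {x = toℚᵘ q} (toℚᵘ-ι (suc b-1)) ⟩
  mkℚᵘ (ℤ.+ a) b-1 ℚᵘ.* mkℚᵘ (ℤ.+ suc b-1) 0
    ≈⟨ *≡* (trans (ℤₚ.*-identityʳ _) (cong (λ x → ℤ.+ a ℤ.* ℤ.+ x) (sym (*-identityʳ (suc b-1))))) ⟩
  mkℚᵘ (ℤ.+ a) 0                         ≈⟨ toℚᵘ-ι a ⟨
  toℚᵘ (ι a)                           ∎)
  where open import Relation.Binary.Reasoning.Setoid ℚᵘₚ.≃-setoid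
clear-denominator (mkℚ ℤ.-[1+ n ] b-1 c) (ℚ.*≤* ())

common-denominator : ∀ {s} (q : Fin s → ℚ) → (∀ i → 0ℚ ≤ℚ q i) →
  Σ[ D ∈ ℕ ] NonZero D × Σ[ W ∈ (Fin s → ℕ) ] (∀ i → q i *ℚ ι D ≡ ι (W i))
common-denominator {zero}  q 0≤q = 1 , _ , (λ ()) , λ ()
common-denominator {suc s} q 0≤q
  with clear-denominator (q zero) (0≤q zero) | common-denominator (q ∘ suc) (0≤q ∘ suc)
... | a , eq | D , D≢0 , W , eqs = b * D , m*n≢0 b D {{_}} {{D≢0}} , W′ , eqs′
  where
  b = ↧ₙ q zero
  W′ : Fin (suc s) → ℕ
  W′ zero    = a * D
  W′ (suc i) = b * W i
  open ≡-Reasoning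
  open ℚ-Solver
  eqs′ : ∀ i → q i *ℚ ι (b * D) ≡ ι (W′ i)
  eqs′ zero = begin
    q zero *ℚ ι (b * D)       ≡⟨ cong (q zero *ℚ_) (ι-* b D) ⟩
    q zero *ℚ (ι b *ℚ ι D)    ≡⟨ ℚₚ.*-assoc (q zero) (ι b) (ι D) ⟨
    q zero *ℚ ι b *ℚ ι D      ≡⟨ cong (_*ℚ ι D) eq ⟩
    ι a *ℚ ι D                ≡⟨ ι-* a D ⟨
    ι (a * D)                 ∎
  eqs′ (suc i) = begin
    q (suc i) *ℚ ι (b * D)       ≡⟨ cong (q (suc i) *ℚ_) (ι-* b D) ⟩
    q (suc i) *ℚ (ι b *ℚ ι D)    ≡⟨ solve 3 (λ q b d → q :* (b :* d) := b :* (q :* d)) refl (q (suc i)) (ι b) (ι D) ⟩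
    ι b *ℚ (q (suc i) *ℚ ι D)    ≡⟨ cong (ι b *ℚ_) (eqs i) ⟩
    ι b *ℚ ι (W i)               ≡⟨ ι-* b (W i) ⟨
    ι (b * W i)                  ∎

common-index : ∀ {s} (R : Fin s → ℕ → Set) → (∀ i {m n} → m ≤ n → R i m → R i n) →
               (∀ i → ∃ (R i)) → ∃[ N ] (∀ i → R i N)
common-index {zero}  R mono found = 0 , λ ()
common-index {suc s} R mono found
  with found zero | common-index (R ∘ suc) (mono ∘ suc) (found ∘ suc)
... | M , r | N , rs = M ⊔ N , λ where
  zero    → mono zero (m≤m⊔n M N) r
  (suc i) → mono (suc i) (m≤n⊔m M N) (rs i)

seq-sumℝ : ∀ {s} (x : Fin s → ℝ) j → seq (sumℝ x) j ≡ sumℚ (λ i → seq (x i) j)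
seq-sumℝ {zero}  x j = refl
seq-sumℝ {suc s} x j = cong (seq (x zero) j +ℚ_) (seq-sumℝ (x ∘ suc) j)

seq-· : ∀ t x j → seq (t · x) j ≡ ι t *ℚ seq x j
seq-· t x j = trans (go t) (sumℚ-const t (seq x j))
  where
  go : ∀ t → seq (t · x) j ≡ sumℚ {t} (λ _ → seq x j)
  go zero    = refl
  go (suc t) = cong (seq x j +ℚ_) (go t)

∣p-q∣≤r⇒p≤q+r : ∀ p q {r} → ∣ p -ℚ q ∣ℚ ≤ℚ r → p ≤ℚ q +ℚ r
∣p-q∣≤r⇒p≤q+r p q {r} le = begin
  p                 ≡⟨ solve 2 (λ p q → p := q :+ (p :- q)) refl p q ⟩
  q +ℚ (p -ℚ q)     ≤⟨ ℚₚ.+-monoʳ-≤ q (≤∣∣ (p -ℚ q)) ⟩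
  q +ℚ ∣ p -ℚ q ∣ℚ  ≤⟨ ℚₚ.+-monoʳ-≤ q le ⟩
  q +ℚ r            ∎
  where
  open ℚₚ.≤-Reasoning
  open ℚ-Solver
  ≤∣∣ : ∀ p → p ≤ℚ ∣ p ∣ℚ
  ≤∣∣ (mkℚ (ℤ.+ a) b c)        = ℚₚ.≤-refl
  ≤∣∣ p@(mkℚ ℤ.-[1+ a ] b c) = ℚₚ.≤-trans (ℚₚ.<⇒≤ (ℚₚ.negative⁻¹ p)) (ℚₚ.0≤∣p∣ p)

-- Natural numbers W i and D such that the weights of a distribution are
-- eventually at most W i / D, where these bounds sum to at most 3.
record Rounding {n} (μ : Distribution n) : Set where
  field
    W       : Fin (size μ) → ℕ
    D       : ℕ
    D≢0     : NonZero D
    N       : ℕ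
    above   : ∀ j → N ≤ j → ∀ i → seq (weight μ i) j *ℚ ι D ≤ℚ ι (W i)
    bounded : sum W ≤ 3 * D

rounding : ∀ {n} (μ : Distribution n) → Rounding μ
rounding μ = record
  { W = W ; D = D ; D≢0 = D≢0 ; N = N
  ; above = λ j N≤j i → subst (seq (weight μ i) j *ℚ ι D ≤ℚ_) (eqs i)
      (ℚₚ.*-monoʳ-≤-nonNeg (ι D) {{ι-nonNegative D}} (close i j N≤j))
  ; bounded = ι-cancel (begin
      ι (sum W)                        ≡⟨ ι-sum W ⟩
      sumℚ (λ i → ι (W i))             ≡⟨ ℚSum.sum-cong-≗ (λ i → sym (eqs i)) ⟩
      sumℚ (λ i → q i *ℚ ι D)          ≡⟨ ℚSum.*-distribʳ-sum (ι D) q ⟨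
      sumℚ q *ℚ ι D                    ≤⟨ ℚₚ.*-monoʳ-≤-nonNeg (ι D) {{ι-nonNegative D}} sum-q ⟩
      ι 3 *ℚ ι D                       ≡⟨ ι-* 3 D ⟨
      ι (3 * D)                        ∎) }
  where
  open ℚₚ.≤-Reasoning
  s = size μ
  instance
    S-positive = ι-positive (suc s)
    S-nonZero  = ℚₚ.pos⇒nonZero (ι (suc s))
  -- The error allowed in each of the s weights, so that the errors sum to less
  -- than 1.
  ε = 1/ ι (suc s)
  0<ε : 0ℚ <ℚ ε
  0<ε = ℚₚ.positive⁻¹ ε {{ℚₚ.1/pos⇒pos (ι (suc s))}}
  x : Fin s → ℕ → ℚ
  x i = seq (weight μ i)

  -- From index N on, the i-th weight varies by at most ε and is at least - ε.
  Settled : Fin s → ℕ → Set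
  Settled i N = (∀ j k → N ≤ j → N ≤ k → ∣ x i j -ℚ x i k ∣ℚ ≤ℚ ε) × (∀ j → N ≤ j → 0ℚ ≤ℚ x i j +ℚ ε)

  settled : ∀ i → ∃ (Settled i)
  settled i with cauchy (weight μ i) ε 0<ε | nonnegative μ i ε 0<ε
  ... | M , c | K , z = M ⊔ K ,
    (λ j k p q → c j k (≤-trans (m≤m⊔n M K) p) (≤-trans (m≤m⊔n M K) q)) ,
    (λ j p → z j (≤-trans (m≤n⊔m M K) p))

  all-settled : ∃[ N ] (∀ i → Settled i N)
  all-settled = common-index Settled
    (λ i m≤n (c , z) → (λ j k p q → c j k (≤-trans m≤n p) (≤-trans m≤n q)) , λ j p → z j (≤-trans m≤n p))
    settled

  total-settled : ∃[ N ] (∀ j → N ≤ j → seq (sumℝ (weight μ)) j ≤ℚ 1ℚ +ℚ 1ℚ)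
  total-settled = proj₁ (total μ) 1ℚ (ℚₚ.positive⁻¹ 1ℚ)

  N = proj₁ all-settled ⊔ proj₁ total-settled

  -- Upper bounds of the weights, from index N on.
  q : Fin s → ℚ
  q i = x i N +ℚ ε

  0≤q : ∀ i → 0ℚ ≤ℚ q i
  0≤q i = proj₂ (proj₂ all-settled i) N (m≤m⊔n _ _)

  close : ∀ i j → N ≤ j → x i j ≤ℚ q i
  close i j N≤j = ∣p-q∣≤r⇒p≤q+r (x i j) (x i N)
    (proj₁ (proj₂ all-settled i) j N (≤-trans (m≤m⊔n _ _) N≤j) (m≤m⊔n _ _))

  sum-q : sumℚ q ≤ℚ ι 3
  sum-q = begin
    sumℚ q                                       ≡⟨ ℚSum.∑-distrib-+ (λ i → x i N) (λ _ → ε) ⟩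
    sumℚ (λ i → x i N) +ℚ sumℚ {s} (λ _ → ε)     ≡⟨ cong₂ _+ℚ_ (sym (seq-sumℝ (weight μ) N)) (sumℚ-const s ε) ⟩
    seq (sumℝ (weight μ)) N +ℚ ι s *ℚ ε          ≤⟨ ℚₚ.+-mono-≤ (proj₂ total-settled N (m≤n⊔m _ _))
                                                     (ℚₚ.*-monoʳ-≤-nonNeg ε {{ℚₚ.pos⇒nonNeg ε {{ℚₚ.1/pos⇒pos (ι (suc s))}}}}
                                                       (ι-mono (n≤1+n s))) ⟩
    1ℚ +ℚ 1ℚ +ℚ ι (suc s) *ℚ ε                   ≡⟨ cong (1ℚ +ℚ 1ℚ +ℚ_) (ℚₚ.*-inverseʳ (ι (suc s))) ⟩
    1ℚ +ℚ 1ℚ +ℚ 1ℚ                               ≡⟨ ι-3 ⟨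
    ι 3                                          ∎

  rational = common-denominator q 0≤q
  D = proj₁ rational
  D≢0 = proj₁ (proj₂ rational)
  W = proj₁ (proj₂ (proj₂ rational))
  eqs = proj₂ (proj₂ (proj₂ rational))

-- Average time

open Sample

module _ {n : ℕ} {C : Code} where

  cost-tabulate : ∀ {s} D (f : Fin s → Sample {n} C) → cost D (List.tabulate f) ≡
    sum (λ i → weight (f i) * steps (input (f i)) D (memory (f i)))
  cost-tabulate {zero}  D f = refl
  cost-tabulate {suc s} D f = cong₂ _+_ refl (cost-tabulate D (f ∘ suc))

  budget-tabulate : ∀ {s} (f : Fin s → Sample {n} C) → budget (List.tabulate f) ≡
    sum (λ i → weight (f i) * bound (f i))
  budget-tabulate {zero}  f = refl
  budget-tabulate {suc s} f = cong₂ _+_ refl (budget-tabulate (f ∘ suc))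

module _ {n} (μ : Distribution n) where

  private
    open Rounding (rounding μ)

    found : ∀ (G : Input n) → Within G (Algorithm.algorithm n) (λ _ → 0) (algorithmTime n)
    found G = run (algorithm-finds G) (λ _ → 0) (λ _ → refl)

    samples : Fin (size μ) → Sample (Algorithm.algorithm n)
    samples i = sample (W i) (algorithmTime n) (outcome μ i) (λ _ → 0) (found (outcome μ i))

    tree : Tree
    tree = proj₁ (derandomize (Algorithm.algorithm n) (List.tabulate samples))

  -- The deterministic algorithm for μ.
  derandomized : PerfectMatchingAlgorithm n
  derandomized = record
    { program = compile 0 tree ++ []
    ; time    = λ G → steps G tree (λ _ → 0)
    ; output  = λ G → final G tree (λ _ → 0)
    ; runs    = λ G → compile-runs G tree (λ _ → 0)
    ; correct = λ G → proj₁ (proj₂ (derandomize (Algorithm.algorithm n) (List.tabulate samples)))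
                        G (λ _ → 0) (algorithmTime n) (found G)
    }

  private
    weighted : sum (λ i → W i * time derandomized (outcome μ i)) ≤ 3 * algorithmTime n * D
    weighted = begin
      sum (λ i → W i * time derandomized (outcome μ i)) ≡⟨ cost-tabulate tree samples ⟨
      cost tree (List.tabulate samples)
        ≤⟨ proj₂ (proj₂ (derandomize (Algorithm.algorithm n) (List.tabulate samples))) ⟩
      budget (List.tabulate samples)                    ≡⟨ budget-tabulate samples ⟩
      sum (λ i → W i * algorithmTime n)                 ≡⟨ *-distribʳ-sum (algorithmTime n) W ⟨
      sum W * algorithmTime n                           ≤⟨ *-monoˡ-≤ (algorithmTime n) bounded ⟩
      3 * D * algorithmTime n
        ≡⟨ solve 2 (λ D t → con 3 :* D :* t := con 3 :* t :* D) refl D (algorithmTime n) ⟩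
      3 * algorithmTime n * D                           ∎
      where open ≤-Reasoning
            open +-*-Solver

  averageTime-derandomized : ∀ j → N ≤ j → seq (averageTime derandomized μ) j ≤ℚ ι (3 * algorithmTime n)
  averageTime-derandomized j N≤j = ℚₚ.*-cancelʳ-≤-pos (ι D) {{ι-positive D {{D≢0}}}} (begin
    seq (averageTime derandomized μ) j *ℚ ι D    ≡⟨ cong (_*ℚ ι D) (seq-sumℝ (λ i → t i · weight μ i) j) ⟩
    sumℚ (λ i → seq (t i · weight μ i) j) *ℚ ι D ≡⟨ ℚSum.*-distribʳ-sum (ι D) (λ i → seq (t i · weight μ i) j) ⟩
    sumℚ (λ i → seq (t i · weight μ i) j *ℚ ι D) ≤⟨ sumℚ-mono term ⟩
    sumℚ (λ i → ι (W i * t i))                   ≡⟨ ι-sum (λ i → W i * t i) ⟨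
    ι (sum (λ i → W i * t i))                    ≤⟨ ι-mono weighted ⟩
    ι (3 * algorithmTime n * D)                  ≡⟨ ι-* (3 * algorithmTime n) D ⟩
    ι (3 * algorithmTime n) *ℚ ι D               ∎)
    where
    open ℚₚ.≤-Reasoning
    t : Fin (size μ) → ℕ
    t i = time derandomized (outcome μ i)
    term : ∀ i → seq (t i · weight μ i) j *ℚ ι D ≤ℚ ι (W i * t i)
    term i = begin
      seq (t i · weight μ i) j *ℚ ι D          ≡⟨ cong (_*ℚ ι D) (seq-· (t i) (weight μ i) j) ⟩
      ι (t i) *ℚ seq (weight μ i) j *ℚ ι D     ≡⟨ ℚₚ.*-assoc (ι (t i)) _ _ ⟩
      ι (t i) *ℚ (seq (weight μ i) j *ℚ ι D)   ≤⟨ ℚₚ.*-monoˡ-≤-nonNeg (ι (t i)) {{ι-nonNegative (t i)}} (above j N≤j i) ⟩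
      ι (t i) *ℚ ι (W i)                       ≡⟨ ι-* (t i) (W i) ⟨
      ι (t i * W i)                            ≡⟨ cong ι (*-comm (t i) (W i)) ⟩
      ι (W i * t i)                            ∎

corollary5 : ∃[ C ] ((n : ℕ) (μ : Distribution n) →
    Σ[ A ∈ PerfectMatchingAlgorithm n ]
    (2 ≤ n → averageTime A μ ≤ℝ fromℕ (C * (n * ⌊log₂ n ⌋))))
-- The factor 45 is from algorithmTime-log, and 3 from the rounding of weights.
corollary5 = 135 , λ n μ → derandomized μ , λ 2≤n ε 0<ε → Rounding.N (rounding μ) , λ j N≤j → (begin
    seq (averageTime (derandomized μ) μ) j  ≤⟨ averageTime-derandomized μ j N≤j ⟩
    ι (3 * algorithmTime n)                 ≤⟨ ι-mono (*-monoʳ-≤ 3 (algorithmTime-log 2≤n)) ⟩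
    ι (3 * (45 * (n * ⌊log₂ n ⌋)))          ≡⟨ cong ι (*-assoc 3 45 (n * ⌊log₂ n ⌋)) ⟨
    ι (135 * (n * ⌊log₂ n ⌋))               ≡⟨ ℚₚ.+-identityʳ _ ⟨
    ι (135 * (n * ⌊log₂ n ⌋)) +ℚ 0ℚ         ≤⟨ ℚₚ.+-monoʳ-≤ (ι (135 * (n * ⌊log₂ n ⌋))) (ℚₚ.<⇒≤ 0<ε) ⟩
    ι (135 * (n * ⌊log₂ n ⌋)) +ℚ ε          ≡⟨ cong (_+ℚ ε) (ι-/1 (135 * (n * ⌊log₂ n ⌋))) ⟩
    seq (fromℕ (135 * (n * ⌊log₂ n ⌋))) j +ℚ ε ∎)
  where open ℚₚ.≤-Reasoning
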